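{- For all $k\in\mathbb{N}$ with $k\ge 3$, every strongly $12k\log^2 k$-connected tournament is $k$-linked.
   Context: A digraph $D$ is strongly $m$-connected if $|D|>m$ and for every $S\subseteq V(D)$ with $|S|\le m-1$, $D-S$ is strongly connected. A digraph $D$ is $k$-linked if $|D|\ge 2k$ and whenever $x_1,\dots,x_k,y_1,\dots,y_k$ are $2k$ distinct vertices of $D$, there exist vertex-disjoint directed paths $P_1,\dots,P_k$ with $P_i$ from $x_i$ to $y_i$. $\log$ is the binary logarithm and $\log^2k=(\log k)^2$. -}

module Defs where

open import Data.Nat using (ℕ; suc; _+_; _*_; _^_; _≤_; _<_; _≥_)
open import Data.Fin using (Fin)
open import Data.Fin.Subset using (Subset; _∉_; ∣_∣)
open import Data.Bool using (Bool; true; false)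
open import Data.List using (List; []; _∷_)
open import Data.List.Relation.Unary.All using (All)
open import Data.List.Relation.Unary.Unique.Propositional using (Unique)
open import Data.List.Membership.Propositional using (_∈_)
open import Data.Product using (Σ; _×_; ∃-syntax)
open import Data.Sum using (_⊎_)
open import Relation.Binary.PropositionalEquality using (_≡_; _≢_)

record Digraph : Set where
  field
    n   : ℕ
    arc : Fin n → Fin n → Bool
open Digraph public

IsTournament : Digraph → Set
IsTournament D =
  (∀ u → arc D u u ≡ false) ×
  (∀ u v → u ≢ v → (arc D u v ≡ true ⊎ arc D v u ≡ true)) ×
  (∀ u v → arc D u v ≡ true → arc D v u ≡ false)

data Walk (D : Digraph) : Fin (n D) → Fin (n D) → List (Fin (n D)) → Set where
  here : ∀ {u} → Walk D u u (u ∷ [])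
  step : ∀ {u w v l} → arc D u w ≡ true → Walk D w v l → Walk D u v (u ∷ l)

IsPath : (D : Digraph) → Fin (n D) → Fin (n D) → List (Fin (n D)) → Set
IsPath D u v l = Walk D u v l × Unique l

StronglyConnectedMinus : (D : Digraph) → Subset (n D) → Set
StronglyConnectedMinus D S =
  ∀ u v → u ∉ S → v ∉ S → ∃[ l ] (Walk D u v l × All (λ w → w ∉ S) l)

-- Real-number thresholds m = 12 k (log₂ k)², encoded by exact rational comparisons.
-- For naturals a, b with b > 0 and k ≥ 1:  a/b ≤ log₂ k  iff  2^a ≤ k^b.
-- (a) N ≤ 12 k log²k  iff every rational r = a/b ≥ 0 with r² < N/(12k)
--     satisfies r ≤ log₂ k.
LeThreshold : ℕ → ℕ → Set
LeThreshold N k = ∀ a b → 1 ≤ b → a * a * (12 * k) < N * (b * b) → 2 ^ a ≤ k ^ b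

-- (b) N > 12 k log²k  iff some rational r = a/b with log₂ k < r has r² < N/(12k).
GtThreshold : ℕ → ℕ → Set
GtThreshold N k = ∃[ a ] ∃[ b ] (1 ≤ b × k ^ b < 2 ^ a × a * a * (12 * k) < N * (b * b))

-- D is strongly (12 k log²k)-connected:  |D| > m and for every S with |S| ≤ m - 1
-- (i.e. |S| + 1 ≤ m), D - S is strongly connected.
StronglyThresholdConnected : ℕ → Digraph → Set
StronglyThresholdConnected k D =
  GtThreshold (n D) k ×
  (∀ (S : Subset (n D)) → LeThreshold (suc ∣ S ∣) k → StronglyConnectedMinus D S)

Linked : ℕ → Digraph → Set
Linked k D =
  2 * k ≤ n D ×
  (∀ (x y : Fin k → Fin (n D)) →
     (∀ i j → x i ≡ x j → i ≡ j) →
     (∀ i j → y i ≡ y j → i ≡ j) →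
     (∀ i j → x i ≢ y j) →
     Σ (Fin k → List (Fin (n D))) λ P →
       (∀ i → IsPath D (x i) (y i) (P i)) ×
       (∀ i j v → v ∈ P i → v ∈ P j → i ≡ j))

module Submission where

-- Choose vertices b₁, …, b_k of least out-degree outside the terminals. Grow each b_i greedily to a
-- transitive set B_i of about log k vertices, each new vertex being one of small out-degree among the
-- common out-neighbours so far: these halve at every step, so all but d⁺(b_i) / 2^c vertices send an
-- arc into B_i, and can continue from there to the last vertex e_i. By reversing arcs, vertices a_i of
-- least in-degree yield sets A_i with ends f_i. Every x_i has an out-neighbour z_i outside everything
-- chosen so far; it has at least as many out-neighbours as each b_j, so one of them, z′_i, sends an arc
-- into every B_j. In the same way one finds w′_i → w_i → y_i such that w′_i receives an arc from every
-- A_j. Finally Menger's theorem gives k disjoint paths from the e_j to the f_j avoiding all other chosen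
-- vertices. Which e_j they join to which f_j is irrelevant: x_i can enter any B_j, and any A_j leads
-- to y_i.

open import Defs
open import Data.Nat using (ℕ; _≥_; zero; suc; _+_; _*_; _^_; _≤_; _<_; z≤n; s≤s; _≤?_; _<?_)
open import Data.Nat.Properties as ℕ using (module ≤-Reasoning)
open import Data.Nat.Solver using (module +-*-Solver)
open import Data.Bool using (Bool; true; false)
import Data.Bool.Properties as Bool
import Data.Vec.Functional as Vector
open import Data.Vec using ([]; _∷_)
open import Data.Fin.Subset as Subset using (Subset; ⊥; ⁅_⁆; _∪_; ∣_∣)
import Data.Fin.Subset.Properties as Subset
open import Data.Fin as Fin using (Fin; zero; suc; _≟_)
import Data.Fin.Properties as Fin
open import Data.List using (List; []; _∷_; _++_; length; filter; concat; tabulate; allFin; lookup; deduplicate; cartesianProduct)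
open import Data.List.Properties using (length-filter; filter-notAll; length-++; length-tabulate)
open import Data.List.Membership.Propositional using (_∈_; _∉_)
open import Data.List.Membership.Propositional.Properties
open import Data.List.Membership.DecPropositional using (_∈?_)
open import Data.List.Relation.Unary.Any as Any using (Any; here; there)
open import Data.List.Relation.Unary.Any.Properties using (lookup-index; lookup-result)
open import Data.List.Relation.Unary.All as All using (All; []; _∷_)
import Data.List.Relation.Unary.All.Properties as All
open import Data.List.Relation.Unary.AllPairs using (AllPairs; []; _∷_)
open import Data.List.Relation.Unary.Unique.Propositional using (Unique)
import Data.List.Relation.Unary.Unique.Propositional.Properties as Unique
import Data.List.Relation.Unary.Unique.DecPropositional.Properties as DecUnique
open import Data.List.Relation.Binary.Subset.Propositional using (_⊆_)
open import Data.Product using (Σ; _×_; _,_; ∃-syntax; proj₁; proj₂)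
open import Data.Sum using (_⊎_; map₂; inj₁; inj₂; [_,_]′)
open import Function using (_∘_; id; case_of_)
open import Function.Definitions using (Injective)
open import Relation.Nullary using (¬_; Dec; yes; no; contradiction; ¬?; _×-dec_)
open import Relation.Binary.PropositionalEquality

-- Finite lists of vertices: pigeonhole, greedy choices, disjoint families.

Inj : {A : Set} {k : ℕ} → (Fin k → A) → Set
Inj f = Injective _≡_ _≡_ f

Disjoint : {A : Set} {k : ℕ} → (Fin k → List A) → Set
Disjoint F = ∀ i j {v} → v ∈ F i → v ∈ F j → i ≡ j

module _ {n : ℕ} where

  infix 4 _∈ᵈ_
  _∈ᵈ_ : (v : Fin n) (vs : List (Fin n)) → Dec (v ∈ vs)
  v ∈ᵈ vs = _∈?_ _≟_ v vs

  ⊆⇒length≤ : {us vs : List (Fin n)} → Unique us → us ⊆ vs → length us ≤ length vs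
  ⊆⇒length≤ {[]} _ _ = z≤n
  ⊆⇒length≤ {u ∷ us} {vs} (u≢ ∷ uniq) sub =
    ℕ.≤-trans (s≤s (⊆⇒length≤ uniq sub′))
      (filter-notAll ≢u? vs (Any.map (λ { refl v≢v → v≢v refl }) (sub (here refl))))
    where
    ≢u? = λ v → ¬? (v ≟ u)
    sub′ : us ⊆ filter ≢u? vs
    sub′ v∈ = ∈-filter⁺ ≢u? (sub (there v∈)) λ { refl → All.lookup u≢ v∈ refl }

  fresh : {us vs : List (Fin n)} → Unique us → length vs < length us → ∃[ u ] (u ∈ us × u ∉ vs)
  fresh {us} {vs} uniq vs<us with Any.any? (λ u → ¬? (u ∈ᵈ vs)) us
  ... | yes p = Any.lookup p , ∈-lookup (Any.index p) , lookup-result p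
  ... | no ¬p = contradiction (⊆⇒length≤ uniq sub) (ℕ.<⇒≱ vs<us)
    where
    sub : us ⊆ vs
    sub {u} u∈ with u ∈ᵈ vs
    ... | yes u∈vs = u∈vs
    ... | no u∉vs = contradiction (Any.map (λ { refl → u∉vs }) u∈) ¬p

  fresh-image : {k : ℕ} {f : Fin k → Fin n} → Inj f → (vs : List (Fin n)) → length vs < k →
    ∃[ i ] (f i ∉ vs)
  fresh-image {k} {f} f-inj vs vs<k
    with fresh {tabulate f} (Unique.tabulate⁺ f-inj) (subst (length vs <_) (sym (length-tabulate f)) vs<k)
  ... | u , u∈ , u∉ with ∈-tabulate⁻ u∈
  ... | i , refl = i , u∉

  -- Distinct representatives are picked greedily: each pick joins the forbidden list, and the
  -- surplus `k` in the size bound pays for the `k` picks.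
  fresh-choice : {k : ℕ} (C : Fin k → List (Fin n)) (F : List (Fin n)) →
    (∀ i → Unique (C i)) → (∀ i → length F + k ≤ length (C i)) →
    Σ (Fin k → Fin n) λ z → (∀ i → z i ∈ C i) × (∀ i → z i ∉ F) × Inj z
  fresh-choice {zero} C F uniq large = (λ ()) , (λ ()) , (λ ()) , λ { {()} }
  fresh-choice {suc k} C F uniq large
    with fresh (uniq zero) (ℕ.<-≤-trans (ℕ.m<m+n (length F) (s≤s z≤n)) (large zero))
  ... | u , u∈ , u∉
    with fresh-choice (C ∘ suc) (u ∷ F) (uniq ∘ suc)
           (λ i → subst (_≤ length (C (suc i))) (ℕ.+-suc (length F) k) (large (suc i)))
  ... | z , z∈ , z∉ , z-inj = z′ , z′∈ , z′∉ , z′-inj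
    where
    z′ : Fin (suc k) → Fin n
    z′ zero = u
    z′ (suc i) = z i
    z′∈ : ∀ i → z′ i ∈ C i
    z′∈ zero = u∈
    z′∈ (suc i) = z∈ i
    z′∉ : ∀ i → z′ i ∉ F
    z′∉ zero = u∉
    z′∉ (suc i) = z∉ i ∘ there
    z′-inj : Inj z′
    z′-inj {zero} {zero} _ = refl
    z′-inj {zero} {suc j} eq = contradiction (here (sym eq)) (z∉ j)
    z′-inj {suc i} {zero} eq = contradiction (here eq) (z∉ i)
    z′-inj {suc i} {suc j} eq = cong suc (z-inj eq)

  least : (f : Fin n → ℕ) {u : Fin n} (us : List (Fin n)) → u ∈ us →
    ∃[ v ] (v ∈ us × ∀ {w} → w ∈ us → f v ≤ f w)
  least f (u ∷ []) _ = u , here refl , λ { (here refl) → ℕ.≤-refl }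
  least f (u ∷ us@(_ ∷ _)) _ with least f us (here refl)
  ... | v , v∈ , v≤ with f u ≤? f v
  ... | yes u≤v = u , here refl , λ { (here refl) → ℕ.≤-refl ; (there w∈) → ℕ.≤-trans u≤v (v≤ w∈) }
  ... | no u≰v = v , there v∈ , λ { (here refl) → ℕ.≰⇒≥ u≰v ; (there w∈) → v≤ w∈ }

  -- Repeatedly take a minimum among the vertices left over. A vertex that is never taken was a
  -- candidate in every round, so no chosen value exceeds its own.
  k-least : (f : Fin n → ℕ) (k : ℕ) (F : List (Fin n)) → length F + k ≤ n →
    Σ (Fin k → Fin n) λ b → Inj b × (∀ i → b i ∉ F) ×
      (∀ {u} → u ∉ F → (∀ i → u ≢ b i) → ∀ i → f (b i) ≤ f u)
  k-least f zero F _ = (λ ()) , (λ { {()} }) , (λ ()) , λ _ _ ()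
  k-least f (suc k) F large
    with fresh (Unique.allFin⁺ n)
           (subst (length F <_) (sym (length-tabulate id))
             (ℕ.<-≤-trans (ℕ.m<m+n (length F) (s≤s z≤n)) large))
  ... | u , u∈ , u∉
    with least f (filter (λ v → ¬? (v ∈ᵈ F)) (allFin n)) (∈-filter⁺ (λ v → ¬? (v ∈ᵈ F)) u∈ u∉)
  ... | v , v∈ , v≤
    with k-least f k (v ∷ F) (subst (_≤ n) (ℕ.+-suc (length F) k) large)
  ... | b , b-inj , b∉ , b≤ = b′ , b′-inj , b′∉ , b′≤
    where
    b′ : Fin (suc k) → Fin n
    b′ zero = v
    b′ (suc i) = b i
    b′-inj : Inj b′
    b′-inj {zero} {zero} _ = refl
    b′-inj {zero} {suc j} eq = contradiction (here (sym eq)) (b∉ j)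
    b′-inj {suc i} {zero} eq = contradiction (here eq) (b∉ i)
    b′-inj {suc i} {suc j} eq = cong suc (b-inj eq)
    b′∉ : ∀ i → b′ i ∉ F
    b′∉ zero = proj₂ (∈-filter⁻ (λ v → ¬? (v ∈ᵈ F)) {xs = allFin n} v∈)
    b′∉ (suc i) = b∉ i ∘ there
    b′≤ : ∀ {u} → u ∉ F → (∀ i → u ≢ b′ i) → ∀ i → f (b′ i) ≤ f u
    b′≤ u∉ u≢ zero = v≤ (∈-filter⁺ (λ v → ¬? (v ∈ᵈ F)) (∈-allFin _) u∉)
    b′≤ u∉ u≢ (suc i) = b≤ (λ { (here eq) → u≢ zero eq ; (there u∈) → u∉ u∈ }) (u≢ ∘ suc) i

  flat : {k : ℕ} → (Fin k → List (Fin n)) → List (Fin n)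
  flat F = concat (tabulate F)

  ∈-flat⁺ : {k : ℕ} (F : Fin k → List (Fin n)) (i : Fin k) → F i ⊆ flat F
  ∈-flat⁺ F i v∈ = ∈-concat⁺′ v∈ (∈-tabulate⁺ i)

  ∈-flat⁻ : {k : ℕ} (F : Fin k → List (Fin n)) {v : Fin n} → v ∈ flat F → ∃[ i ] (v ∈ F i)
  ∈-flat⁻ F v∈ with ∈-concat⁻′ (tabulate F) v∈
  ... | vs , v∈vs , vs∈ with ∈-tabulate⁻ vs∈
  ... | i , refl = i , v∈vs

  -- The factor `m` keeps bounds of the form c / m free of division; it will be the power of two by
  -- which missed sets shrink.
  length-flat-* : {k : ℕ} (F : Fin k → List (Fin n)) (m c : ℕ) → (∀ i → length (F i) * m ≤ c) →
    length (flat F) * m ≤ k * c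
  length-flat-* {zero} F m c bound = z≤n
  length-flat-* {suc k} F m c bound = begin
    length (F zero ++ flat (F ∘ suc)) * m            ≡⟨ cong (_* m) (length-++ (F zero)) ⟩
    (length (F zero) + length (flat (F ∘ suc))) * m  ≡⟨ ℕ.*-distribʳ-+ m (length (F zero)) _ ⟩
    length (F zero) * m + length (flat (F ∘ suc)) * m
      ≤⟨ ℕ.+-mono-≤ (bound zero) (length-flat-* (F ∘ suc) m c (bound ∘ suc)) ⟩
    c + k * c                                        ∎
    where open ≤-Reasoning

  length-flat : {k : ℕ} (F : Fin k → List (Fin n)) (c : ℕ) → (∀ i → length (F i) ≤ c) →
    length (flat F) ≤ k * c
  length-flat F c bound = subst (_≤ _) (ℕ.*-identityʳ _)
    (length-flat-* F 1 c (λ i → subst (_≤ c) (sym (ℕ.*-identityʳ _)) (bound i)))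

  Disjoint-++ : {k : ℕ} {F G : Fin k → List (Fin n)} → Disjoint F → Disjoint G →
    (∀ i j {v} → v ∈ F i → v ∉ G j) → Disjoint (λ i → F i ++ G i)
  Disjoint-++ {F = F} {G} dF dG dFG i j v∈i v∈j with ∈-++⁻ (F i) v∈i | ∈-++⁻ (F j) v∈j
  ... | inj₁ p | inj₁ q = dF i j p q
  ... | inj₁ p | inj₂ q = contradiction q (dFG i j p)
  ... | inj₂ p | inj₁ q = contradiction p (dFG j i q)
  ... | inj₂ p | inj₂ q = dG i j p q

injective⇒surjective : {n : ℕ} {f : Fin n → Fin n} → Inj f → ∀ j → ∃[ i ] (f i ≡ j)
injective⇒surjective {n} {f} f-inj j with j ∈ᵈ tabulate f
... | yes j∈ = let i , eq = ∈-tabulate⁻ j∈ in i , sym eq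
... | no j∉ = contradiction
  (⊆⇒length≤ (All.tabulate (λ { v∈ refl → j∉ v∈ }) ∷ Unique.tabulate⁺ f-inj) (λ {v} _ → ∈-allFin v))
  (subst₂ (λ a b → ¬ (suc a ≤ b)) (sym (length-tabulate f)) (sym (length-tabulate id)) ℕ.1+n≰n)

-- Trails, their surgery and loop erasure.

module _ {n : ℕ} where

  -- This is `Walk` over an arbitrary relation, so that the same surgery serves both the arcs of a
  -- digraph and the arc lists on which the induction for Menger's theorem runs.
  data Trail (R : Fin n → Fin n → Set) : Fin n → Fin n → List (Fin n) → Set where
    here : ∀ {u} → Trail R u u (u ∷ [])
    step : ∀ {u w v l} → R u w → Trail R w v l → Trail R u v (u ∷ l)

  module _ {R : Fin n → Fin n → Set} where

    source∈ : ∀ {u v l} → Trail R u v l → u ∈ l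
    source∈ here = here refl
    source∈ (step _ _) = here refl

    target∈ : ∀ {u v l} → Trail R u v l → v ∈ l
    target∈ here = here refl
    target∈ (step _ t) = there (target∈ t)

    -- The last component records that a proper initial segment of a path misses the end of the
    -- path. The disjointness argument in `splice` rests on it, and on its mirror image in `suffix`.
    prefix : ∀ {u v w l} → Trail R u v l → w ∈ l →
      ∃[ l₁ ] (Trail R u w l₁ × l₁ ⊆ l × (Unique l → v ∈ l₁ → w ≡ v))
    prefix here (here refl) = _ , here , id , λ _ _ → refl
    prefix (step _ t) (here refl) =
      _ , here , (λ { (here refl) → here refl }) ,
      λ { (u≢ ∷ _) (here refl) → refl }
    prefix (step r t) (there w∈) with prefix t w∈
    ... | l₁ , t₁ , sub , uniq =
      _ , step r t₁ , (λ { (here eq) → here eq ; (there a∈) → there (sub a∈) }) ,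
      λ { (u≢ ∷ _) (here refl) → contradiction refl (All.lookup u≢ (target∈ t))
        ; (_ ∷ un) (there v∈) → uniq un v∈ }

    suffix : ∀ {u v w l} → Trail R u v l → w ∈ l →
      ∃[ l₂ ] (Trail R w v l₂ × l₂ ⊆ l × (Unique l → Unique l₂) × (Unique l → u ∈ l₂ → w ≡ u))
    suffix t@here (here refl) = _ , t , id , id , λ _ _ → refl
    suffix t@(step _ _) (here refl) = _ , t , id , id , λ _ _ → refl
    suffix (step _ t) (there w∈) with suffix t w∈
    ... | l₂ , t₂ , sub , uniq , _ =
      _ , t₂ , there ∘ sub , (λ { (_ ∷ un) → uniq un }) ,
      λ { (u≢ ∷ _) u∈ → contradiction refl (All.lookup u≢ (sub u∈)) }

    -- Loops are erased from the back: if the new first vertex recurs in the simplified rest,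
    -- everything before that recurrence is dropped.
    simplify : ∀ {u v l} → Trail R u v l → ∃[ l′ ] (Trail R u v l′ × l′ ⊆ l × Unique l′)
    simplify here = _ , here , id , [] ∷ []
    simplify {u} (step r t) with simplify t
    ... | l′ , t′ , sub , uniq with u ∈ᵈ l′
    ... | yes u∈ = let l₂ , t₂ , sub₂ , uniq₂ , _ = suffix t′ u∈ in
                   l₂ , t₂ , there ∘ sub ∘ sub₂ , uniq₂ uniq
    ... | no u∉ = _ , step r t′ , (λ { (here eq) → here eq ; (there a∈) → there (sub a∈) }) ,
                  All.tabulate (λ { a∈ refl → u∉ a∈ }) ∷ uniq

    join : ∀ {u w v l₁ l₂} → Trail R u w l₁ → Trail R w v l₂ →
      ∃[ l ] (Trail R u v l × l ⊆ l₁ ++ l₂)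
    join here t₂ = _ , t₂ , there
    join (step r t₁) t₂ with join t₁ t₂
    ... | l , t , sub = _ , step r t , λ { (here eq) → here eq ; (there a∈) → there (sub a∈) }

    bridge : ∀ {u x y v l₁ l₂} → Trail R u x l₁ → R x y → Trail R y v l₂ → Trail R u v (l₁ ++ l₂)
    bridge here r t₂ = step r t₂
    bridge (step r′ t₁) r t₂ = step r′ (bridge t₁ r t₂)

  Trail-map : {R R′ : Fin n → Fin n → Set} → (∀ {u w} → R u w → R′ u w) →
    ∀ {u v l} → Trail R u v l → Trail R′ u v l
  Trail-map f here = here
  Trail-map f (step r t) = step (f r) (Trail-map f t)

  -- Menger's theorem, by induction on the list of arcs.

  Arcs : Set
  Arcs = List (Fin n × Fin n)

  ArcTrail : Arcs → Fin n → Fin n → List (Fin n) → Set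
  ArcTrail E = Trail (λ u w → (u , w) ∈ E)

  -- When the new arc is used, cut before its first use and after its last one: both outer pieces
  -- run in `E`, and whatever happens in between is irrelevant for separators.
  first-last-use : ∀ {x y E u v l} → ArcTrail ((x , y) ∷ E) u v l →
    ArcTrail E u v l ⊎
    ∃[ l₁ ] ∃[ l₂ ] (ArcTrail E u x l₁ × l₁ ⊆ l × ArcTrail E y v l₂ × l₂ ⊆ l)
  first-last-use here = inj₁ here
  first-last-use (step (here refl) t) with first-last-use t
  ... | inj₁ t′ = inj₂ (_ , _ , here , (λ { (here eq) → here eq }) , t′ , there)
  ... | inj₂ (_ , l₂ , _ , _ , t₂ , sub₂) =
    inj₂ (_ , l₂ , here , (λ { (here eq) → here eq }) , t₂ , there ∘ sub₂)
  first-last-use (step (there r) t) with first-last-use t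
  ... | inj₁ t′ = inj₁ (step r t′)
  ... | inj₂ (l₁ , l₂ , t₁ , sub₁ , t₂ , sub₂) =
    inj₂ (_ , l₂ , step r t₁ , (λ { (here eq) → here eq ; (there a∈) → there (sub₁ a∈) }) ,
          t₂ , there ∘ sub₂)

  -- The pairing of sources with targets is left open, as in Menger's theorem. A path may be a
  -- single vertex, and injectivity of `src` and `tgt` follows from disjointness.
  record DisjointPaths (E : Arcs) {a b} (A : Fin a → Fin n) (B : Fin b → Fin n) (k : ℕ) : Set where
    field
      src      : Fin k → Fin a
      tgt      : Fin k → Fin b
      path     : Fin k → List (Fin n)
      trail    : ∀ i → ArcTrail E (A (src i)) (B (tgt i)) (path i)
      unique   : ∀ i → Unique (path i)
      disjoint : Disjoint path

    src-injective : Inj src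
    src-injective {i} {j} eq = disjoint i j (source∈ (trail i))
      (subst (λ c → A c ∈ path j) (sym eq) (source∈ (trail j)))

    tgt-injective : Inj tgt
    tgt-injective {i} {j} eq = disjoint i j (target∈ (trail i))
      (subst (λ c → B c ∈ path j) (sym eq) (target∈ (trail j)))

  -- The separator may contain vertices of `A` and `B`. It may also repeat vertices, so `s` is only
  -- an upper bound for its size.
  Separates : Arcs → ∀ {a b s} → (Fin a → Fin n) → (Fin b → Fin n) → (Fin s → Fin n) → Set
  Separates E A B S = ∀ i j {l} → ArcTrail E (A i) (B j) l → ∃[ t ] (S t ∈ l)

  -- The inductive step of Göring's proof: S separates A from B without the arc (x , y), and each
  -- of S ∪ {x}, S ∪ {y} is linked to its side. Paths from different sides meet only in S.
  splice : ∀ {x y E a b s} {A : Fin a → Fin n} {B : Fin b → Fin n} {S : Fin s → Fin n} →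
    Separates E A B S →
    DisjointPaths E A (x Vector.∷ S) (suc s) → DisjointPaths E (y Vector.∷ S) B (suc s) →
    DisjointPaths ((x , y) ∷ E) A B (suc s)
  splice {x} {y} {E} {s = s} {A} {B} {S} sep Ps Qs = record
    { src = P.src ∘ α
    ; tgt = Q.tgt ∘ β
    ; path = λ i → proj₁ (spliced i)
    ; trail = λ i → proj₁ (proj₂ (spliced i))
    ; unique = λ i → proj₂ (proj₂ (proj₂ (spliced i)))
    ; disjoint = disj
    }
    where
    module P = DisjointPaths Ps
    module Q = DisjointPaths Qs
    -- There are as many paths as vertices to link to, so every such vertex ends a path of `Ps` and
    -- starts one of `Qs`. Indexing by these vertices matches the two families.
    α β : Fin (suc s) → Fin (suc s)
    α j = proj₁ (injective⇒surjective P.tgt-injective j)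
    β j = proj₁ (injective⇒surjective Q.src-injective j)
    tgt-α : ∀ j → P.tgt (α j) ≡ j
    tgt-α j = proj₂ (injective⇒surjective P.tgt-injective j)
    src-β : ∀ j → Q.src (β j) ≡ j
    src-β j = proj₂ (injective⇒surjective Q.src-injective j)
    trailᴾ : ∀ j → ArcTrail E (A (P.src (α j))) ((x Vector.∷ S) j) (P.path (α j))
    trailᴾ j = subst (λ i → ArcTrail E (A (P.src (α j))) ((x Vector.∷ S) i) (P.path (α j))) (tgt-α j) (P.trail (α j))
    trailQ : ∀ j → ArcTrail E ((y Vector.∷ S) j) (B (Q.tgt (β j))) (Q.path (β j))
    trailQ j = subst (λ i → ArcTrail E ((y Vector.∷ S) i) (B (Q.tgt (β j))) (Q.path (β j))) (src-β j) (Q.trail (β j))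
    α-unique : ∀ {a t} → S t ∈ P.path a → α (suc t) ≡ a
    α-unique {a} {t} = P.disjoint (α (suc t)) a (target∈ (trailᴾ (suc t)))
    β-unique : ∀ {b t} → S t ∈ Q.path b → β (suc t) ≡ b
    β-unique {b} {t} = Q.disjoint (β (suc t)) b (source∈ (trailQ (suc t)))

    spliced : ∀ j → ∃[ l ] (ArcTrail ((x , y) ∷ E) (A (P.src (α j))) (B (Q.tgt (β j))) l ×
                            l ⊆ P.path (α j) ++ Q.path (β j) × Unique l)
    spliced zero = simplify
      (bridge (Trail-map there (trailᴾ zero)) (here refl) (Trail-map there (trailQ zero)))
    spliced (suc j) =
      let l , t , sub = join (trailᴾ (suc j)) (trailQ (suc j))
          l′ , t′ , sub′ , uniq = simplify (Trail-map there t)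
      in l′ , t′ , sub ∘ sub′ , uniq

    -- Following the first path up to `v` and the second from `v` on gives an `E`-trail from `A` to
    -- `B`, which meets `S`. If it does so before `v`, disjointness makes that vertex of `S` the end
    -- of the first path, so the initial segment is the whole path and `v` is that vertex; the
    -- second path then starts there. The other case is symmetric.
    meet : ∀ i j {v} → v ∈ P.path (α i) → v ∈ Q.path (β j) → i ≡ j
    meet i j v∈p v∈q with prefix (trailᴾ i) v∈p | suffix (trailQ j) v∈q
    ... | l₁ , t₁ , sub₁ , last | l₂ , t₂ , sub₂ , _ , first with join t₁ t₂
    ... | l , t , sub with sep _ _ t
    ... | r , Sr∈ with ∈-++⁻ l₁ (sub Sr∈)
    ... | inj₁ Sr∈l₁ = same (trans (sym (tgt-α (suc r))) (trans (cong P.tgt (α-unique (sub₁ Sr∈l₁))) (tgt-α i)))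
      where
      same : suc r ≡ i → i ≡ j
      same refl with last (P.unique (α i)) Sr∈l₁
      ... | refl = trans (sym (src-β (suc r))) (trans (cong Q.src (β-unique v∈q)) (src-β j))
    ... | inj₂ Sr∈l₂ = same (trans (sym (src-β (suc r))) (trans (cong Q.src (β-unique (sub₂ Sr∈l₂))) (src-β j)))
      where
      same : suc r ≡ j → i ≡ j
      same refl with first (Q.unique (β j)) Sr∈l₂
      ... | refl = sym (trans (sym (tgt-α (suc r))) (trans (cong P.tgt (α-unique v∈p)) (tgt-α i)))

    disj : Disjoint (λ i → proj₁ (spliced i))
    disj i j v∈i v∈j
      with ∈-++⁻ (P.path (α i)) (proj₁ (proj₂ (proj₂ (spliced i))) v∈i)
         | ∈-++⁻ (P.path (α j)) (proj₁ (proj₂ (proj₂ (spliced j))) v∈j)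
    ... | inj₁ p | inj₁ q = trans (sym (tgt-α i)) (trans (cong P.tgt (P.disjoint _ _ p q)) (tgt-α j))
    ... | inj₁ p | inj₂ q = meet i j p q
    ... | inj₂ p | inj₁ q = sym (meet j i q p)
    ... | inj₂ p | inj₂ q = trans (sym (src-β i)) (trans (cong Q.src (Q.disjoint _ _ p q)) (src-β j))

  module _ {x y : Fin n} {E : Arcs} {a b s : ℕ} {A : Fin a → Fin n} {B : Fin b → Fin n} {S : Fin s → Fin n}
           (sep : Separates E A B S) where

    separates-with-endpoint : Separates ((x , y) ∷ E) A B (x Vector.∷ S)
    separates-with-endpoint i j t with first-last-use t
    ... | inj₁ t′ = let r , Sr∈ = sep i j t′ in suc r , Sr∈
    ... | inj₂ (_ , _ , t₁ , sub₁ , _) = zero , sub₁ (target∈ t₁)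

    -- Every trail from `A` to `B` reaches `x` or a vertex of `S` by arcs of `E` alone, and `S′`
    -- already meets this first stretch.
    separates-source : ∀ {s′} {S′ : Fin s′ → Fin n} →
      Separates E A (x Vector.∷ S) S′ → Separates ((x , y) ∷ E) A B S′
    separates-source sep′ i j t with first-last-use t
    ... | inj₂ (_ , _ , t₁ , sub₁ , _) = let r , S′r∈ = sep′ i zero t₁ in r , sub₁ S′r∈
    ... | inj₁ t′ with sep i j t′
    ... | q , Sq∈ with prefix t′ Sq∈
    ... | _ , t₁ , sub₁ , _ = let r , S′r∈ = sep′ i (suc q) t₁ in r , sub₁ S′r∈

    separates-target : ∀ {s′} {S′ : Fin s′ → Fin n} →
      Separates E (y Vector.∷ S) B S′ → Separates ((x , y) ∷ E) A B S′
    separates-target sep′ i j t with first-last-use t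
    ... | inj₂ (_ , _ , _ , _ , t₂ , sub₂) = let r , S′r∈ = sep′ zero j t₂ in r , sub₂ S′r∈
    ... | inj₁ t′ with sep i j t′
    ... | q , Sq∈ with suffix t′ Sq∈
    ... | _ , t₂ , sub₂ , _ = let r , S′r∈ = sep′ (suc q) j t₂ in r , sub₂ S′r∈

  arcless : ∀ {u v l} → ArcTrail [] u v l → u ≡ v × l ≡ u ∷ []
  arcless here = refl , refl

  menger : (E : Arcs) {a b : ℕ} (A : Fin a → Fin n) (B : Fin b → Fin n) (k : ℕ) →
    DisjointPaths E A B k ⊎ ∃[ s ] Σ (Fin s → Fin n) λ S → s < k × Separates E A B S
  -- Without arcs the only trails are single vertices, so the number of disjoint paths is the number
  -- of vertices common to `A` and `B`, counted without repetition.
  menger [] A B k with k ≤? length (deduplicate _≟_ (filter (_∈ᵈ tabulate B) (tabulate A)))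
  ... | no k≰ = inj₂ (_ , lookup common , ℕ.≰⇒> k≰ , sep)
    where
    common = deduplicate _≟_ (filter (_∈ᵈ tabulate B) (tabulate A))
    sep : Separates [] A B (lookup common)
    sep i j t with arcless t
    ... | Ai≡Bj , refl = Any.index Ai∈ , here (sym (lookup-index Ai∈))
      where
      Ai∈ : A i ∈ common
      Ai∈ = ∈-deduplicate⁺ _≟_ (∈-filter⁺ (_∈ᵈ tabulate B) (∈-tabulate⁺ i)
              (subst (_∈ tabulate B) (sym Ai≡Bj) (∈-tabulate⁺ j)))
  ... | yes k≤
    with fresh-choice {k = k} (λ _ → _) [] (λ _ → DecUnique.deduplicate-! _≟_ _) (λ _ → k≤)
  ... | z , z∈ , _ , z-inj = inj₁ record
    { src = λ i → proj₁ (from-A i)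
    ; tgt = λ i → proj₁ (from-B i)
    ; path = λ i → z i ∷ []
    ; trail = λ i → subst₂ (λ u v → ArcTrail [] u v (z i ∷ [])) (proj₂ (from-A i)) (proj₂ (from-B i)) here
    ; unique = λ i → [] ∷ []
    ; disjoint = λ { i j (here refl) (here eq) → z-inj eq }
    }
    where
    z∈A∩B : ∀ i → z i ∈ tabulate A × z i ∈ tabulate B
    z∈A∩B i = ∈-filter⁻ (_∈ᵈ tabulate B) {xs = tabulate A} (∈-deduplicate⁻ _≟_ _ (z∈ i))
    from-A : ∀ i → ∃[ j ] (z i ≡ A j)
    from-A i = ∈-tabulate⁻ (proj₁ (z∈A∩B i))
    from-B : ∀ i → ∃[ j ] (z i ≡ B j)
    from-B i = ∈-tabulate⁻ (proj₂ (z∈A∩B i))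
  menger ((x , y) ∷ E) A B k with menger E A B k
  ... | inj₁ Ps = inj₁ record { DisjointPaths Ps ; trail = Trail-map there ∘ DisjointPaths.trail Ps }
  ... | inj₂ (s , S , s<k , sep) with suc s <? k
  ... | yes 1+s<k = inj₂ (suc s , x Vector.∷ S , 1+s<k , separates-with-endpoint sep)
  ... | no 1+s≮k with ℕ.≤-antisym s<k (ℕ.≮⇒≥ 1+s≮k)
  -- Now k = s + 1, and adding an end of the new arc to `S` would no longer give a small separator.
  -- Instead each side is linked to `S` with one end of the arc, or else a small separator on one
  -- side works for the whole.
  ... | refl with menger E A (x Vector.∷ S) (suc s) | menger E (y Vector.∷ S) B (suc s)
  ... | inj₂ (s′ , S′ , s′<k , sep′) | _ = inj₂ (s′ , S′ , s′<k , separates-source sep sep′)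
  ... | inj₁ _ | inj₂ (s′ , S′ , s′<k , sep′) = inj₂ (s′ , S′ , s′<k , separates-target sep sep′)
  ... | inj₁ Ps | inj₁ Qs = inj₁ (splice sep Ps Qs)

-- Reversal and double counting.

reverse : Digraph → Digraph
reverse D = record { n = n D ; arc = λ u v → arc D v u }

reverse-tournament : {D : Digraph} → IsTournament D → IsTournament (reverse D)
reverse-tournament (irr , total , asym) =
  irr , (λ u v u≢v → total v u (u≢v ∘ sym)) , (λ u v → asym v u)

sumOver : {A : Set} → (A → ℕ) → List A → ℕ
sumOver f [] = 0
sumOver f (x ∷ xs) = f x + sumOver f xs

module _ {A : Set} where

  sumOver-0 : (xs : List A) → sumOver (λ _ → 0) xs ≡ 0
  sumOver-0 [] = refl
  sumOver-0 (_ ∷ xs) = sumOver-0 xs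

  sumOver-+ : (f g : A → ℕ) (xs : List A) →
    sumOver (λ x → f x + g x) xs ≡ sumOver f xs + sumOver g xs
  sumOver-+ f g [] = refl
  sumOver-+ f g (x ∷ xs) = trans (cong (f x + g x +_) (sumOver-+ f g xs))
    (interchange (f x) (g x) (sumOver f xs) (sumOver g xs))
    where open import Algebra.Properties.CommutativeSemigroup ℕ.+-commutativeSemigroup using (interchange)

  sumOver-swap : (g : A → A → ℕ) (xs ys : List A) →
    sumOver (λ x → sumOver (g x) ys) xs ≡ sumOver (λ y → sumOver (λ x → g x y) xs) ys
  sumOver-swap g [] ys = sym (sumOver-0 ys)
  sumOver-swap g (x ∷ xs) ys = trans (cong (sumOver (g x) ys +_) (sumOver-swap g xs ys))
    (sym (sumOver-+ (g x) (λ y → sumOver (λ x → g x y) xs) ys))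

  sumOver-≤ : {f g : A → ℕ} (xs : List A) → (∀ {x} → x ∈ xs → f x ≤ g x) →
    sumOver f xs ≤ sumOver g xs
  sumOver-≤ [] _ = z≤n
  sumOver-≤ (_ ∷ xs) f≤g = ℕ.+-mono-≤ (f≤g (here refl)) (sumOver-≤ xs (f≤g ∘ there))

  sumOver-1 : (xs : List A) → sumOver (λ _ → 1) xs ≡ length xs
  sumOver-1 [] = refl
  sumOver-1 (_ ∷ xs) = cong suc (sumOver-1 xs)

bit : Bool → ℕ
bit true = 1
bit false = 0

length-filter-bit : {A : Set} (p : A → Bool) (xs : List A) →
  length (filter (λ x → p x Bool.≟ true) xs) ≡ sumOver (bit ∘ p) xs
length-filter-bit p [] = refl
length-filter-bit p (x ∷ xs) with p x
... | true = cong suc (length-filter-bit p xs)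
... | false = length-filter-bit p xs

-- Out-degrees and funnels in tournaments.

module _ (D : Digraph) where

  outIn : List (Fin (n D)) → Fin (n D) → List (Fin (n D))
  outIn C v = filter (λ u → arc D v u Bool.≟ true) C

  out : Fin (n D) → List (Fin (n D))
  out = outIn (allFin (n D))

  out-unique : ∀ v → Unique (out v)
  out-unique v = Unique.filter⁺ (λ u → arc D v u Bool.≟ true) (Unique.allFin⁺ (n D))

  ∈-outIn⁺ : ∀ {C v u} → u ∈ C → arc D v u ≡ true → u ∈ outIn C v
  ∈-outIn⁺ {v = v} = ∈-filter⁺ (λ u → arc D v u Bool.≟ true)

  ∈-outIn⁻ : ∀ {C v u} → u ∈ outIn C v → u ∈ C × arc D v u ≡ true
  ∈-outIn⁻ {C} {v} = ∈-filter⁻ (λ u → arc D v u Bool.≟ true) {xs = C}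

  -- Each v in funnel i is a stepping stone to its end: the set is a transitive subtournament.
  record Funnels {k} (F : List (Fin (n D))) (b : Fin k → Fin (n D)) (c : ℕ) : Set where
    field
      set         : Fin k → List (Fin (n D))
      end         : Fin k → Fin (n D)
      missed      : Fin k → List (Fin (n D))
      start∈      : ∀ i → b i ∈ set i
      end∈        : ∀ i → end i ∈ set i
      avoids      : ∀ i {v} → v ∈ set i → v ≡ b i ⊎ v ∉ F
      disjoint    : Disjoint set
      size        : ∀ i → length (set i) ≤ suc c
      missed-size : ∀ i → length (missed i) * 2 ^ c ≤ length (out (b i))
      catches     : ∀ i {u} → u ∉ F → (∀ j → u ∉ set j) → u ∉ missed i →
                    ∃[ v ] (v ∈ set i × arc D u v ≡ true × (v ≡ end i ⊎ arc D v (end i) ≡ true))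

  module _ (tour : IsTournament D) where

    irreflexive : ∀ {v} → arc D v v ≢ true
    irreflexive {v} eq with trans (sym eq) (proj₁ tour v)
    ... | ()

    total : ∀ {u v} → u ≢ v → arc D u v ≡ true ⊎ arc D v u ≡ true
    total = proj₁ (proj₂ tour) _ _

    bit-asym : ∀ u v → bit (arc D u v) + bit (arc D v u) ≤ 1
    bit-asym u v with arc D u v in eq
    ... | true rewrite proj₂ (proj₂ tour) u v eq = ℕ.≤-refl
    ... | false with arc D v u
    ... | true = ℕ.≤-refl
    ... | false = z≤n

    -- Within `C` the out-degrees and the in-degrees have the same sum, so some vertex has
    -- out-degree at most its in-degree; the two add up to at most the length of `C`.
    few-out : ∀ C {u} → u ∈ C → ∃[ v ] (v ∈ C × length (outIn C v) * 2 ≤ length C)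
    few-out C u∈ = balanced (Any.any? (λ v → outdeg v ≤? indeg v) C)
      where
      outdeg indeg : Fin (n D) → ℕ
      outdeg v = sumOver (λ u → bit (arc D v u)) C
      indeg v = sumOver (λ u → bit (arc D u v)) C
      sum-< : ∀ vs {u} → u ∈ vs → (∀ {v} → v ∈ vs → indeg v < outdeg v) →
        sumOver indeg vs < sumOver outdeg vs
      sum-< (v ∷ vs) _ lt = ℕ.+-mono-<-≤ (lt (here refl)) (sumOver-≤ vs (λ v∈ → ℕ.<⇒≤ (lt (there v∈))))
      balanced : Dec (Any (λ v → outdeg v ≤ indeg v) C) →
        ∃[ v ] (v ∈ C × length (outIn C v) * 2 ≤ length C)
      balanced (no none) = contradiction (sumOver-swap (λ v u → bit (arc D v u)) C C)
        (ℕ.>⇒≢ (sum-< C u∈ (λ v∈ → ℕ.≰⇒> (λ o≤i → none (Any.map (λ { refl → o≤i }) v∈)))))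
      balanced (yes some) = v , ∈-lookup (Any.index some) , (begin
        length (outIn C v) * 2     ≡⟨ cong (_* 2) (length-filter-bit (arc D v) C) ⟩
        outdeg v * 2               ≡⟨ ℕ.*-comm (outdeg v) 2 ⟩
        outdeg v + (outdeg v + 0)  ≡⟨ cong (outdeg v +_) (ℕ.+-identityʳ (outdeg v)) ⟩
        outdeg v + outdeg v        ≤⟨ ℕ.+-monoʳ-≤ (outdeg v) (lookup-result some) ⟩
        outdeg v + indeg v         ≡⟨ sumOver-+ (λ u → bit (arc D v u)) (λ u → bit (arc D u v)) C ⟨
        sumOver (λ u → bit (arc D v u) + bit (arc D u v)) C ≤⟨ sumOver-≤ C (λ {u} _ → bit-asym v u) ⟩
        sumOver (λ _ → 1) C        ≡⟨ sumOver-1 C ⟩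
        length C                   ∎)
        where
        open ≤-Reasoning
        v = Any.lookup some

    -- Pick a vertex v with few out-neighbours in `C` and continue inside these. A vertex of `C`
    -- other than v either sends an arc to v or is still present in the next round. The candidates
    -- at least halve each time; those surviving `c` rounds form `M`. Each pick is dominated by all
    -- earlier ones, which makes the picks transitive.
    chain : ∀ c (C : List (Fin (n D))) → ∃[ B ] ∃[ M ]
      (B ⊆ C × length B ≤ c × AllPairs (λ u v → arc D u v ≡ true) B × length M * 2 ^ c ≤ length C ×
       (∀ {u} → u ∈ C → u ∉ B → u ∉ M → ∃[ v ] (v ∈ B × arc D u v ≡ true)))
    chain c [] = [] , [] , (λ ()) , z≤n , [] , z≤n , λ ()
    chain zero C = [] , C , (λ ()) , z≤n , [] , ℕ.≤-reflexive (ℕ.*-identityʳ _) ,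
      λ u∈ _ u∉ → contradiction u∈ u∉
    chain (suc c) C@(_ ∷ _) with few-out C (here refl)
    ... | v , v∈ , half with chain c (outIn C v)
    ... | B , M , sub , len , pairs , small , cover =
      v ∷ B , M , (λ { (here refl) → v∈ ; (there u∈) → proj₁ (∈-outIn⁻ {C} (sub u∈)) }) , s≤s len ,
      All.tabulate (λ u∈ → proj₂ (∈-outIn⁻ {C} (sub u∈))) ∷ pairs , small′ , cover′
      where
      small′ : length M * 2 ^ suc c ≤ length C
      small′ = begin
        length M * (2 * 2 ^ c)   ≡⟨ cong (length M *_) (ℕ.*-comm 2 (2 ^ c)) ⟩
        length M * (2 ^ c * 2)   ≡⟨ ℕ.*-assoc (length M) (2 ^ c) 2 ⟨
        length M * 2 ^ c * 2     ≤⟨ ℕ.*-monoˡ-≤ 2 small ⟩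
        length (outIn C v) * 2   ≤⟨ half ⟩
        length C                 ∎
        where open ≤-Reasoning
      cover′ : ∀ {u} → u ∈ C → u ∉ v ∷ B → u ∉ M → ∃[ w ] (w ∈ v ∷ B × arc D u w ≡ true)
      cover′ u∈ u∉ u∉M with total (u∉ ∘ here)
      ... | inj₁ u→v = v , here refl , u→v
      ... | inj₂ v→u = let w , w∈ , u→w = cover (∈-outIn⁺ u∈ v→u) (u∉ ∘ there) u∉M in w , there w∈ , u→w

    -- In a transitive order the final vertex receives an arc from every earlier one, so a funnel is
    -- traversed from any entry by at most one arc.
    last : ∀ b B → AllPairs (λ u v → arc D u v ≡ true) (b ∷ B) →
      ∃[ e ] (e ∈ b ∷ B × ∀ {v} → v ∈ b ∷ B → v ≡ e ⊎ arc D v e ≡ true)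
    last b [] _ = b , here refl , λ { (here eq) → inj₁ eq }
    last b (b′ ∷ B) (b→ ∷ pairs) with last b′ B pairs
    ... | e , e∈ , to-e = e , there e∈ , λ { (here refl) → inj₂ (All.lookup b→ e∈) ; (there v∈) → to-e v∈ }

    -- All starts lie in `F`, so no funnel swallows the start of another. Each finished funnel joins
    -- the forbidden list for the later ones, which makes the funnels disjoint.
    funnels : ∀ {k} F (b : Fin k → Fin (n D)) c → Inj b → (∀ i → b i ∈ F) → Funnels F b c
    funnels {zero} F b c _ _ = record
      { set = λ () ; end = λ () ; missed = λ () ; start∈ = λ () ; end∈ = λ () ; avoids = λ ()
      ; disjoint = λ () ; size = λ () ; missed-size = λ () ; catches = λ () }
    funnels {suc k} F b c b-inj b∈
      with chain c (filter (λ v → ¬? (v ∈ᵈ F)) (out (b zero)))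
    ... | B , M , sub , len , pairs , small , cover
      with last (b zero) B (All.tabulate (λ v∈ → proj₂ (∈-outIn⁻ {allFin (n D)} (proj₁ (∉F v∈)))) ∷ pairs)
      where
      ∉F : ∀ {v} → v ∈ B → v ∈ out (b zero) × v ∉ F
      ∉F v∈ = ∈-filter⁻ (λ v → ¬? (v ∈ᵈ F)) {xs = out (b zero)} (sub v∈)
    ... | e , e∈ , to-e = record
      { set = set₀ Vector.∷ T.set
      ; end = e Vector.∷ T.end
      ; missed = M Vector.∷ T.missed
      ; start∈ = λ { zero → here refl ; (suc i) → T.start∈ i }
      ; end∈ = λ { zero → e∈ ; (suc i) → T.end∈ i }
      ; avoids = λ { zero → avoids₀ ; (suc i) → λ v∈ → map₂ (_∘ ∈-++⁺ʳ set₀) (T.avoids i v∈) }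
      ; disjoint = λ { zero zero _ _ → refl
                     ; zero (suc j) v∈₀ v∈ → contradiction v∈ (apart j v∈₀)
                     ; (suc i) zero v∈ v∈₀ → contradiction v∈ (apart i v∈₀)
                     ; (suc i) (suc j) v∈i v∈j → cong suc (T.disjoint i j v∈i v∈j) }
      ; size = λ { zero → s≤s len ; (suc i) → T.size i }
      ; missed-size = λ { zero → ℕ.≤-trans small (length-filter (λ v → ¬? (v ∈ᵈ F)) (out (b zero)))
                        ; (suc i) → T.missed-size i }
      ; catches = λ { zero → λ u∉F u∉ u∉M → catches₀ u∉F (u∉ zero) u∉M
                    ; (suc i) → λ u∉F u∉ →
                        T.catches i ([ u∉ zero , u∉F ]′ ∘ ∈-++⁻ set₀) (u∉ ∘ suc) }
      }
      where
      set₀ : List (Fin (n D))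
      set₀ = b zero ∷ B
      module T = Funnels (funnels (set₀ ++ F) (b ∘ suc) c (Fin.suc-injective ∘ b-inj) (∈-++⁺ʳ set₀ ∘ b∈ ∘ suc))
      avoids₀ : ∀ {v} → v ∈ set₀ → v ≡ b zero ⊎ v ∉ F
      avoids₀ (here eq) = inj₁ eq
      avoids₀ (there v∈) = inj₂ (proj₂ (∈-filter⁻ (λ v → ¬? (v ∈ᵈ F)) {xs = out (b zero)} (sub v∈)))
      apart : ∀ j {v} → v ∈ set₀ → v ∉ T.set j
      apart j v∈₀ v∈ with T.avoids j v∈
      ... | inj₂ v∉ = v∉ (∈-++⁺ˡ v∈₀)
      ... | inj₁ refl with avoids₀ v∈₀
      ... | inj₂ v∉F = v∉F (b∈ (suc j))
      ... | inj₁ eq = case b-inj eq of λ ()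
      catches₀ : ∀ {u} → u ∉ F → u ∉ set₀ → u ∉ M →
        ∃[ v ] (v ∈ set₀ × arc D u v ≡ true × (v ≡ e ⊎ arc D v e ≡ true))
      catches₀ u∉F u∉ u∉M with total (u∉ ∘ here)
      ... | inj₁ u→b = b zero , here refl , u→b , to-e (here refl)
      ... | inj₂ b→u = let v , v∈ , u→v = cover (∈-filter⁺ (λ v → ¬? (v ∈ᵈ F)) (∈-outIn⁺ (∈-allFin _) b→u) u∉F) (u∉ ∘ there) u∉M
                       in v , there v∈ , u→v , to-e (there v∈)

-- Connectivity forces large degrees.

ListConnected : ℕ → Digraph → Set
ListConnected N D = ∀ (T : List (Fin (n D))) → length T < N → ∀ {u v} → u ∉ T → v ∉ T →
  ∃[ l ] (Walk D u v l × All (_∉ T) l)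

module _ {D : Digraph} where

  Walk⇒Trail : ∀ {u v l} → Walk D u v l → Trail (λ u v → arc D u v ≡ true) u v l
  Walk⇒Trail here = here
  Walk⇒Trail (step r t) = step r (Walk⇒Trail t)

  Trail⇒Walk : ∀ {u v l} → Trail (λ u v → arc D u v ≡ true) u v l → Walk D u v l
  Trail⇒Walk here = here
  Trail⇒Walk (step r t) = step r (Trail⇒Walk t)

module _ {m : ℕ} {R : Fin m → Fin m → Set} where

  first-arc : ∀ {u v l} → Trail R u v l → u ≢ v → ∃[ w ] (w ∈ l × R u w)
  first-arc here u≢v = contradiction refl u≢v
  first-arc (step r t) _ = _ , there (source∈ t) , r

  last-arc : ∀ {u v l} → Trail R u v l → u ≢ v → ∃[ w ] (w ∈ l × R w v)
  last-arc here u≢v = contradiction refl u≢v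
  last-arc (step r t) _ = last-arc-of-step r t
    where
    last-arc-of-step : ∀ {u w v l} → R u w → Trail R w v l → ∃[ w′ ] (w′ ∈ u ∷ l × R w′ v)
    last-arc-of-step r here = _ , here refl , r
    last-arc-of-step _ (step r t) = let w , w∈ , r′ = last-arc-of-step r t in w , there w∈ , r′

module _ {N : ℕ} {D : Digraph} (tour : IsTournament D) (conn : ListConnected N D) (N<n : N < n D) where

  private
    other : ∀ v L → length L < N → ∃[ u ] (v ≢ u × u ∉ L)
    other v L L<N with fresh {vs = v ∷ L} (Unique.allFin⁺ (n D))
      (subst (suc (length L) <_) (sym (length-tabulate id)) (ℕ.≤-<-trans L<N N<n))
    ... | u , _ , u∉ = u , (λ { refl → u∉ (here refl) }) , u∉ ∘ there

  -- Deleting fewer than `N` out-neighbours, if these were all, would leave `v` without an outgoing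
  -- arc, yet some other vertex remains because `N < n D`.
  out-degree≥ : ∀ v → N ≤ length (out D v)
  out-degree≥ v = ℕ.≮⇒≥ λ few →
    let u , v≢u , u∉ = other v (out D v) few
        l , t , l∉ = conn (out D v) few (irreflexive D tour ∘ proj₂ ∘ ∈-outIn⁻ D {allFin (n D)}) u∉
        w , w∈ , r = first-arc (Walk⇒Trail t) v≢u
    in All.lookup l∉ w∈ (∈-outIn⁺ D (∈-allFin w) r)

  in-degree≥ : ∀ v → N ≤ length (out (reverse D) v)
  in-degree≥ v = ℕ.≮⇒≥ λ few →
    let u , v≢u , u∉ = other v (out (reverse D) v) few
        l , t , l∉ = conn (out (reverse D) v) few u∉
                       (irreflexive D tour ∘ proj₂ ∘ ∈-outIn⁻ (reverse D) {allFin (n D)})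
        w , w∈ , r = last-arc (Walk⇒Trail t) (v≢u ∘ sym)
    in All.lookup l∉ w∈ (∈-outIn⁺ (reverse D) (∈-allFin w) r)

-- Disjoint cells: the vertices reserved for each route outside the funnels.

record Cells {m k : ℕ} (Z : List (Fin m)) (t : ℕ) : Set where
  field
    cell     : Fin k → List (Fin m)
    disjoint : Disjoint cell
    avoids   : ∀ i {v} → v ∈ cell i → v ∉ Z
    size     : ∀ i → length (cell i) ≤ t

  occupied : List (Fin m)
  occupied = flat cell ++ Z

  occupied-size : length occupied ≤ k * t + length Z
  occupied-size = subst (_≤ k * t + length Z) (sym (length-++ (flat cell)))
    (ℕ.+-monoˡ-≤ (length Z) (length-flat cell t size))

module _ {m k : ℕ} {Z : List (Fin m)} {t : ℕ} where

  enlarge : (C : Cells {m} {k} Z t) {z : Fin k → Fin m} → Inj z → (∀ i → z i ∉ Cells.occupied C) →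
    Cells {m} {k} Z (suc t)
  enlarge C {z} z-inj z∉ = record
    { cell = λ i → z i ∷ cell i
    ; disjoint = λ { i j (here refl) (here eq) → z-inj eq
                   ; i j (here refl) (there v∈) → contradiction (∈-++⁺ˡ (∈-flat⁺ cell j v∈)) (z∉ i)
                   ; i j (there v∈) (here refl) → contradiction (∈-++⁺ˡ (∈-flat⁺ cell i v∈)) (z∉ j)
                   ; i j (there v∈) (there v∈′) → disjoint i j v∈ v∈′ }
    ; avoids = λ { i (here refl) v∈Z → z∉ i (∈-++⁺ʳ (flat cell) v∈Z) ; i (there v∈) → avoids i v∈ }
    ; size = λ i → s≤s (size i)
    }
    where open Cells C

  -- In continuation-passing style, since projections from nested existentials grow exponentially.
  extend : (C : Cells {m} {k} Z t) (A : Fin k → List (Fin m)) (M : List (Fin m)) →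
    (∀ i → Unique (A i)) → (∀ i → length M + (k * suc t + length Z) ≤ length (A i)) →
    {X : Set} →
    ((z : Fin k → Fin m) → (∀ i → z i ∈ A i) → (∀ i → z i ∉ M) → (∀ i → z i ∉ Cells.occupied C) →
     (C′ : Cells {m} {k} Z (suc t)) → (∀ i → z i ∷ Cells.cell C i ⊆ Cells.cell C′ i) →
     (∀ {u} → u ∉ Cells.occupied C′ → u ∉ Cells.occupied C) → X) → X
  extend C A M uniq large continue with fresh-choice A (M ++ occupied) uniq room
    where
    open Cells C
    open ≤-Reasoning
    open +-*-Solver
    room : ∀ i → length (M ++ occupied) + k ≤ length (A i)
    room i = begin
      length (M ++ occupied) + k           ≡⟨ cong (_+ k) (length-++ M) ⟩
      length M + length occupied + k       ≡⟨ ℕ.+-assoc (length M) _ k ⟩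
      length M + (length occupied + k)     ≤⟨ ℕ.+-monoʳ-≤ (length M) (ℕ.+-monoˡ-≤ k occupied-size) ⟩
      length M + (k * t + length Z + k)    ≡⟨ cong (length M +_) (solve 3 (λ k t z → k :* t :+ z :+ k := k :* (con 1 :+ t) :+ z) refl k t (length Z)) ⟩
      length M + (k * suc t + length Z)    ≤⟨ large i ⟩
      length (A i)                         ∎
  ... | z , z∈ , z∉ , z-inj =
    continue z z∈ (λ i → z∉ i ∘ ∈-++⁺ˡ) z∉C (enlarge C z-inj z∉C) (λ _ → id) smaller
    where
    open Cells C
    z∉C : ∀ i → z i ∉ occupied
    z∉C i = z∉ i ∘ ∈-++⁺ʳ M
    smaller : ∀ {u} → u ∉ flat (λ i → z i ∷ cell i) ++ Z → u ∉ flat cell ++ Z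
    smaller u∉ u∈ with ∈-++⁻ (flat cell) u∈
    ... | inj₁ p = let i , u∈i = ∈-flat⁻ cell p in u∉ (∈-++⁺ˡ (∈-flat⁺ (λ i → z i ∷ cell i) i (there u∈i)))
    ... | inj₂ p = u∉ (∈-++⁺ʳ (flat (λ i → z i ∷ cell i)) p)

-- Piecing a single route together.

double-cancel : ∀ {a b} → a + a ≤ b + b → a ≤ b
double-cancel aa≤bb = ℕ.≮⇒≥ λ b<a → ℕ.<⇒≱ (ℕ.+-mono-< b<a b<a) aa≤bb

module _ {m : ℕ} {R : Fin m → Fin m → Set} where

  arrive : ∀ {u v e} → R u v → v ≡ e ⊎ R v e → ∃[ l ] (Trail R u e l × l ⊆ u ∷ v ∷ e ∷ [])
  arrive u→v (inj₁ refl) = _ , step u→v here ,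
    λ { (here eq) → here eq ; (there (here eq)) → there (here eq) }
  arrive u→v (inj₂ v→e) = _ , step u→v (step v→e here) , id

  depart : ∀ {f v w y l} → v ≡ f ⊎ R f v → R v w → Trail R w y l →
    ∃[ l′ ] (Trail R f y l′ × l′ ⊆ f ∷ v ∷ l)
  depart (inj₁ refl) v→w t = _ , step v→w t , λ { (here eq) → here eq ; (there a∈) → there (there a∈) }
  depart (inj₂ f→v) v→w t = _ , step f→v (step v→w t) , id

  -- Entry and end of a funnel may coincide and pieces may cross, so the joined trail is simplified.
  -- Disjointness of routes needs only an inclusion of vertex sets, which survives simplification.
  concatenate : ∀ {x z z′ v e f p u w′ w y} →
    R x z → R z z′ → R z′ v → v ≡ e ⊎ R v e → Trail R e f p → u ≡ f ⊎ R f u → R u w′ → R w′ w → R w y →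
    ∃[ l ] (Trail R x y l × l ⊆ (x ∷ z ∷ z′ ∷ v ∷ e ∷ []) ++ p ++ (f ∷ u ∷ w′ ∷ w ∷ y ∷ []) × Unique l)
  concatenate {x} {z} {z′} {v} {e} {f} {p} {u} {w′} {w} {y} x→z z→z′ z′→v v→e t f→u u→w′ w′→w w→y
    with arrive z′→v v→e | depart f→u u→w′ (step w′→w (step w→y here))
  ... | l₁ , t₁ , sub₁ | l₃ , t₃ , sub₃ with join t t₃
  ... | l₂ , t₂ , sub₂ with join (step x→z (step z→z′ t₁)) t₂
  ... | l₀ , t₀ , sub₀ with simplify t₀
  ... | l , tₗ , sub , uniq = l , tₗ , inside ∘ ∈-++⁻ (x ∷ z ∷ l₁) ∘ sub₀ ∘ sub , uniq
    where
    inside : ∀ {q} → q ∈ x ∷ z ∷ l₁ ⊎ q ∈ l₂ →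
      q ∈ (x ∷ z ∷ z′ ∷ v ∷ e ∷ []) ++ p ++ (f ∷ u ∷ w′ ∷ w ∷ y ∷ [])
    inside (inj₁ (here eq)) = here eq
    inside (inj₁ (there (here eq))) = there (here eq)
    inside (inj₁ (there (there q∈))) = there (there (∈-++⁺ˡ (sub₁ q∈)))
    inside (inj₂ q∈) with ∈-++⁻ p (sub₂ q∈)
    ... | inj₁ q∈p = ∈-++⁺ʳ (x ∷ z ∷ z′ ∷ v ∷ e ∷ []) (∈-++⁺ˡ q∈p)
    ... | inj₂ q∈l₃ = ∈-++⁺ʳ (x ∷ z ∷ z′ ∷ v ∷ e ∷ []) (∈-++⁺ʳ p (sub₃ q∈l₃))

-- Menger's theorem away from a set of vertices.

module _ (D : Digraph) (S : List (Fin (n D))) where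

  private
    Outside : Fin (n D) × Fin (n D) → Set
    Outside (u , v) = arc D u v ≡ true × u ∉ S × v ∉ S

    outside? : ∀ a → Dec (Outside a)
    outside? (u , v) = (arc D u v Bool.≟ true) ×-dec (¬? (u ∈ᵈ S) ×-dec ¬? (v ∈ᵈ S))

  arcsOutside : Arcs
  arcsOutside = filter outside? (cartesianProduct (allFin (n D)) (allFin (n D)))

  ∈-arcsOutside⁻ : ∀ {u v} → (u , v) ∈ arcsOutside → arc D u v ≡ true × u ∉ S × v ∉ S
  ∈-arcsOutside⁻ r = proj₂ (∈-filter⁻ outside? {xs = cartesianProduct (allFin (n D)) (allFin (n D))} r)

  outside⁺ : ∀ {u v l} → Trail (λ u v → arc D u v ≡ true) u v l → All (_∉ S) l → ArcTrail arcsOutside u v l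
  outside⁺ here _ = here
  outside⁺ (step r t) (u∉ ∷ l∉) = step
    (∈-filter⁺ outside? (∈-cartesianProduct⁺ (∈-allFin _) (∈-allFin _)) (r , u∉ , All.lookup l∉ (source∈ t)))
    (outside⁺ t l∉)

  -- A trail without arcs says nothing about `S`, hence the separate hypothesis on its start.
  outside⁻ : ∀ {u v l} → ArcTrail arcsOutside u v l → u ∉ S → All (_∉ S) l
  outside⁻ here u∉ = u∉ ∷ []
  outside⁻ (step r t) u∉ = u∉ ∷ outside⁻ t (proj₂ (proj₂ (∈-arcsOutside⁻ r)))

  -- A separator of fewer than `k` vertices misses some `e i` and some `f j`. Together with `S` it
  -- has fewer than `N` vertices, so after deleting both there is still a walk from `e i` to `f j`,
  -- a contradiction.
  menger-outside : ∀ {N k} → ListConnected N D → length S + k ≤ N →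
    (e f : Fin k → Fin (n D)) → Inj e → Inj f → (∀ i → e i ∉ S) → (∀ i → f i ∉ S) →
    DisjointPaths arcsOutside e f k
  menger-outside {N} {k} conn small e f e-inj f-inj e∉ f∉ with menger arcsOutside e f k
  ... | inj₁ Ps = Ps
  ... | inj₂ (s , T , s<k , sep) =
    let T<k = subst (_< k) (sym (length-tabulate T)) s<k
        i , ei∉ = fresh-image e-inj (tabulate T) T<k
        j , fj∉ = fresh-image f-inj (tabulate T) T<k
        l , t , l∉ = conn (S ++ tabulate T)
          (subst (_< N) (sym (length-++ S)) (ℕ.<-≤-trans (ℕ.+-monoʳ-< (length S) T<k) small))
          ([ e∉ i , ei∉ ]′ ∘ ∈-++⁻ S) ([ f∉ j , fj∉ ]′ ∘ ∈-++⁻ S)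
        r , Tr∈ = sep i j (outside⁺ (Walk⇒Trail t) (All.map (_∘ ∈-++⁺ˡ) l∉))
    in contradiction (∈-++⁺ʳ S (∈-tabulate⁺ r)) (All.lookup l∉ Tr∈)

module _ {D : Digraph} {k c : ℕ} {F : List (Fin (n D))} {b : Fin k → Fin (n D)} (B : Funnels D F b c) where
  open Funnels B

  -- Each funnel misses at most d / 2^c ≤ d / 2k vertices, so all `k` of them together miss at most
  -- half of `d`.
  missed-total : 1 ≤ k → k + k ≤ 2 ^ c → ∀ d → (∀ i → length (out D (b i)) ≤ d) →
    length (flat missed) + length (flat missed) ≤ d
  missed-total (s≤s {n = k′} z≤n) 2k≤ d deg = ℕ.*-cancelˡ-≤ (suc k′) (begin
    k * (ms + ms)   ≡⟨ solve 2 (λ k m → k :* (m :+ m) := m :* (k :+ k)) refl k ms ⟩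
    ms * (k + k)    ≤⟨ ℕ.*-monoʳ-≤ ms 2k≤ ⟩
    ms * 2 ^ c      ≤⟨ length-flat-* missed (2 ^ c) d (λ i → ℕ.≤-trans (missed-size i) (deg i)) ⟩
    k * d           ∎)
    where
    open ≤-Reasoning
    open +-*-Solver
    ms = length (flat missed)

  end-injective : Inj end
  end-injective {i} {j} eq = disjoint i j (end∈ i) (subst (_∈ set j) (sym eq) (end∈ j))

-- At most spent k c vertices make up the terminals, two more vertices next to each of them, and
-- 2k funnels; the budget leaves room for as many missed vertices.
spent budget : ℕ → ℕ → ℕ
spent k c = k * 6 + (k * suc c + k * suc c)
budget k c = spent k c + spent k c

module _ {D : Digraph} {k c N : ℕ} {F G : List (Fin (n D))} {b a : Fin k → Fin (n D)}
  (Bs : Funnels D F b c) (As : Funnels (reverse D) G a c)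
  (A∩B : ∀ i j {v} → v ∈ Funnels.set As i → v ∉ Funnels.set Bs j)
  (C : Cells {n D} {k} (flat (Funnels.set Bs) ++ flat (Funnels.set As)) 6) where

  private
    module B = Funnels Bs
    module A = Funnels As
    module U = Cells C

  -- `α` and `β` record the pairing of funnels that Menger's theorem happens to produce. A territory
  -- holds every vertex its route may use, so routes are disjoint as soon as territories are.
  record Lanes : Set where
    field
      α β       : Fin k → Fin k
      path      : Fin k → List (Fin (n D))
      trail     : ∀ i → Trail (λ u v → arc D u v ≡ true) (B.end (α i)) (A.end (β i)) (path i)
      territory : Fin k → List (Fin (n D))
      disjoint  : Disjoint territory
      U⊆        : ∀ i → U.cell i ⊆ territory i
      B⊆        : ∀ i → B.set (α i) ⊆ territory i
      A⊆        : ∀ i → A.set (β i) ⊆ territory i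
      path⊆     : ∀ i → path i ⊆ territory i

  private
    ends : List (Fin (n D))
    ends = tabulate B.end ++ tabulate A.end

    inner : List (Fin (n D)) → List (Fin (n D))
    inner = filter (λ v → ¬? (v ∈ᵈ ends))

    inner⁻ : ∀ {vs v} → v ∈ inner vs → v ∈ vs × v ∉ ends
    inner⁻ {vs} = ∈-filter⁻ (λ v → ¬? (v ∈ᵈ ends)) {xs = vs}

    -- The linking paths must avoid the rest of the funnels but start and finish at the ends, so the
    -- ends are taken out.
    B° A° : Fin k → List (Fin (n D))
    B° = inner ∘ B.set
    A° = inner ∘ A.set

    B-split : ∀ i {v} → v ∈ B.set i → v ∈ B° i ⊎ v ≡ B.end i
    B-split i {v} v∈ with v ∈ᵈ ends
    ... | no v∉ = inj₁ (∈-filter⁺ (λ v → ¬? (v ∈ᵈ ends)) v∈ v∉)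
    ... | yes v∈ends with ∈-++⁻ (tabulate B.end) v∈ends
    ... | inj₁ p = let j , eq = ∈-tabulate⁻ p in
      inj₂ (trans eq (cong B.end (B.disjoint j i (B.end∈ j) (subst (_∈ B.set i) eq v∈))))
    ... | inj₂ p = let j , eq = ∈-tabulate⁻ p in
      contradiction (subst (_∈ B.set i) eq v∈) (A∩B j i (A.end∈ j))

    A-split : ∀ i {v} → v ∈ A.set i → v ∈ A° i ⊎ v ≡ A.end i
    A-split i {v} v∈ with v ∈ᵈ ends
    ... | no v∉ = inj₁ (∈-filter⁺ (λ v → ¬? (v ∈ᵈ ends)) v∈ v∉)
    ... | yes v∈ends with ∈-++⁻ (tabulate B.end) v∈ends
    ... | inj₁ p = let j , eq = ∈-tabulate⁻ p in
      contradiction (B.end∈ j) (A∩B i j (subst (_∈ A.set i) eq v∈))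
    ... | inj₂ p = let j , eq = ∈-tabulate⁻ p in
      inj₂ (trans eq (cong A.end (A.disjoint j i (A.end∈ j) (subst (_∈ A.set i) eq v∈))))

    S : List (Fin (n D))
    S = flat U.cell ++ flat B° ++ flat A°

    U⊆S : ∀ i → U.cell i ⊆ S
    U⊆S i = ∈-++⁺ˡ ∘ ∈-flat⁺ U.cell i
    B°⊆S : ∀ i → B° i ⊆ S
    B°⊆S i = ∈-++⁺ʳ (flat U.cell) ∘ ∈-++⁺ˡ ∘ ∈-flat⁺ B° i
    A°⊆S : ∀ i → A° i ⊆ S
    A°⊆S i = ∈-++⁺ʳ (flat U.cell) ∘ ∈-++⁺ʳ (flat B°) ∘ ∈-flat⁺ A° i

    inner-size : ∀ vs → length vs ≤ suc c → length (inner vs) ≤ suc c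
    inner-size vs = ℕ.≤-trans (length-filter (λ v → ¬? (v ∈ᵈ ends)) vs)

    |S|≤ : length S ≤ spent k c
    |S|≤ = subst (_≤ spent k c)
      (sym (trans (length-++ (flat U.cell)) (cong (length (flat U.cell) +_) (length-++ (flat B°)))))
      (ℕ.+-mono-≤ (length-flat U.cell 6 U.size) (ℕ.+-mono-≤
        (length-flat B° (suc c) (λ i → inner-size (B.set i) (B.size i)))
        (length-flat A° (suc c) (λ i → inner-size (A.set i) (A.size i)))))

    end∉S : ∀ {v} → v ∈ flat B.set ++ flat A.set → v ∈ ends → v ∉ S
    end∉S v∈Z v∈ends v∈S with ∈-++⁻ (flat U.cell) v∈S
    ... | inj₁ p = let i , v∈U = ∈-flat⁻ U.cell p in U.avoids i v∈U v∈Z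
    ... | inj₂ p with ∈-++⁻ (flat B°) p
    ... | inj₁ q = let i , v∈B = ∈-flat⁻ B° q in proj₂ (inner⁻ {B.set i} v∈B) v∈ends
    ... | inj₂ q = let i , v∈A = ∈-flat⁻ A° q in proj₂ (inner⁻ {A.set i} v∈A) v∈ends

    B-end∉S : ∀ i → B.end i ∉ S
    B-end∉S i = end∉S (∈-++⁺ˡ (∈-flat⁺ B.set i (B.end∈ i))) (∈-++⁺ˡ (∈-tabulate⁺ i))

    A-end∉S : ∀ i → A.end i ∉ S
    A-end∉S i = end∉S (∈-++⁺ʳ (flat B.set) (∈-flat⁺ A.set i (A.end∈ i))) (∈-++⁺ʳ (tabulate B.end) (∈-tabulate⁺ i))

    B°⊆B : ∀ i → B° i ⊆ B.set i
    B°⊆B i = proj₁ ∘ inner⁻ {B.set i}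
    A°⊆A : ∀ i → A° i ⊆ A.set i
    A°⊆A i = proj₁ ∘ inner⁻ {A.set i}

    lanes-along : DisjointPaths (arcsOutside D S) B.end A.end k → Lanes
    lanes-along Ps = record
      { α = P.src
      ; β = P.tgt
      ; path = P.path
      ; trail = λ i → Trail-map (proj₁ ∘ ∈-arcsOutside⁻ D S) (P.trail i)
      ; territory = territory
      ; disjoint = Disjoint-++ U.disjoint (Disjoint-++ B-disjoint (Disjoint-++ A-disjoint P.disjoint A∩P) B∩AP) U∩BAP
      ; U⊆ = λ i → ∈-++⁺ˡ
      ; B⊆ = λ i → [ ∈-++⁺ʳ (U.cell i) ∘ ∈-++⁺ˡ , (λ { refl → path⊆ i (source∈ (P.trail i)) }) ]′ ∘ B-split (P.src i)
      ; A⊆ = λ i → [ ∈-++⁺ʳ (U.cell i) ∘ ∈-++⁺ʳ (B° (P.src i)) ∘ ∈-++⁺ˡ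
                   , (λ { refl → path⊆ i (target∈ (P.trail i)) }) ]′ ∘ A-split (P.tgt i)
      ; path⊆ = path⊆
      }
      where
      module P = DisjointPaths Ps
      -- The two funnel ends belong to the path; listing the funnels without them makes the four
      -- pieces disjoint.
      territory : Fin k → List (Fin (n D))
      territory i = U.cell i ++ B° (P.src i) ++ A° (P.tgt i) ++ P.path i
      path⊆ : ∀ i → P.path i ⊆ territory i
      path⊆ i = ∈-++⁺ʳ (U.cell i) ∘ ∈-++⁺ʳ (B° (P.src i)) ∘ ∈-++⁺ʳ (A° (P.tgt i))
      path∉S : ∀ i {v} → v ∈ P.path i → v ∉ S
      path∉S i = All.lookup (outside⁻ D S (P.trail i) (B-end∉S (P.src i)))
      B-disjoint : Disjoint (B° ∘ P.src)
      B-disjoint i j p q = P.src-injective (B.disjoint _ _ (B°⊆B (P.src i) p) (B°⊆B (P.src j) q))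
      A-disjoint : Disjoint (A° ∘ P.tgt)
      A-disjoint i j p q = P.tgt-injective (A.disjoint _ _ (A°⊆A (P.tgt i) p) (A°⊆A (P.tgt j) q))
      A∩P : ∀ i j {v} → v ∈ A° (P.tgt i) → v ∉ P.path j
      A∩P i j v∈A v∈P = path∉S j v∈P (A°⊆S (P.tgt i) v∈A)
      B∩AP : ∀ i j {v} → v ∈ B° (P.src i) → v ∉ A° (P.tgt j) ++ P.path j
      B∩AP i j v∈B v∈AP with ∈-++⁻ (A° (P.tgt j)) v∈AP
      ... | inj₁ v∈A = A∩B _ _ (A°⊆A (P.tgt j) v∈A) (B°⊆B (P.src i) v∈B)
      ... | inj₂ v∈P = path∉S j v∈P (B°⊆S (P.src i) v∈B)
      U∩BAP : ∀ i j {v} → v ∈ U.cell i → v ∉ B° (P.src j) ++ A° (P.tgt j) ++ P.path j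
      U∩BAP i j v∈U v∈BAP with ∈-++⁻ (B° (P.src j)) v∈BAP
      ... | inj₁ v∈B = U.avoids i v∈U (∈-++⁺ˡ (∈-flat⁺ B.set _ (B°⊆B (P.src j) v∈B)))
      ... | inj₂ v∈AP with ∈-++⁻ (A° (P.tgt j)) v∈AP
      ... | inj₁ v∈A = U.avoids i v∈U (∈-++⁺ʳ (flat B.set) (∈-flat⁺ A.set _ (A°⊆A (P.tgt j) v∈A)))
      ... | inj₂ v∈P = path∉S j v∈P (U⊆S i v∈U)

  lanes : budget k c ≤ N → ListConnected N D → Lanes
  lanes budget≤N conn = lanes-along
    (menger-outside D S conn
      -- One half of the budget covers `S`, and the other half easily covers the additional `k`.
      (ℕ.≤-trans (ℕ.+-mono-≤ |S|≤ (ℕ.≤-trans (ℕ.m≤m*n k 6) (ℕ.m≤m+n (k * 6) _))) budget≤N)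
      B.end A.end (end-injective Bs) (end-injective As) B-end∉S A-end∉S)

-- Choosing the vertices next to the terminals, and the routes.

Routes : (D : Digraph) {k : ℕ} (x y : Fin k → Fin (n D)) → Set
Routes D {k} x y = Σ (Fin k → List (Fin (n D))) λ P →
  (∀ i → IsPath D (x i) (y i) (P i)) × (∀ i j v → v ∈ P i → v ∈ P j → i ≡ j)

module _ {D : Digraph} (tour : IsTournament D) {k c N : ℕ} (1≤k : 1 ≤ k) (2k≤2^c : k + k ≤ 2 ^ c)
  (budget≤N : budget k c ≤ N) (N<n : N < n D) (conn : ListConnected N D)
  (x y : Fin k → Fin (n D)) where

  module _ {F G : List (Fin (n D))} {b a : Fin k → Fin (n D)}
    (Bs : Funnels D F b c) (As : Funnels (reverse D) G a c)
    (A∩B : ∀ i j {v} → v ∈ Funnels.set As i → v ∉ Funnels.set Bs j)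
    (C₂ : Cells {n D} {k} (flat (Funnels.set Bs) ++ flat (Funnels.set As)) 2)
    (x∈ : ∀ i → x i ∈ Cells.cell C₂ i) (y∈ : ∀ i → y i ∈ Cells.cell C₂ i)
    (b-lowest : ∀ {u} → u ∉ Cells.occupied C₂ → ∀ i → length (out D (b i)) ≤ length (out D u))
    (a-lowest : ∀ {u} → u ∉ Cells.occupied C₂ → ∀ i → length (out (reverse D) (a i)) ≤ length (out (reverse D) u))
    (caughtᴮ : ∀ {u} i → u ∉ Cells.occupied C₂ → u ∉ Funnels.missed Bs i →
      ∃[ v ] (v ∈ Funnels.set Bs i × arc D u v ≡ true × (v ≡ Funnels.end Bs i ⊎ arc D v (Funnels.end Bs i) ≡ true)))
    (caughtᴬ : ∀ {u} i → u ∉ Cells.occupied C₂ → u ∉ Funnels.missed As i →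
      ∃[ v ] (v ∈ Funnels.set As i × arc D v u ≡ true × (v ≡ Funnels.end As i ⊎ arc D (Funnels.end As i) v ≡ true)))
    where

    private
      module B = Funnels Bs
      module A = Funnels As

      Z : List (Fin (n D))
      Z = flat B.set ++ flat A.set

      |Z|≤ : length Z ≤ k * suc c + k * suc c
      |Z|≤ = subst (_≤ k * suc c + k * suc c) (sym (length-++ (flat B.set)))
        (ℕ.+-mono-≤ (length-flat B.set (suc c) B.size) (length-flat A.set (suc c) A.size))

      -- At most half of the `d` candidates are missed. The used vertices together with the new ones
      -- number at most `spent k c`, half of the budget and so at most the other half of `d`.
      room : ∀ t ms {d} → suc t ≤ 6 → ms + ms ≤ d → N ≤ d → ms + (k * suc t + length Z) ≤ d
      room t ms {d} t<6 2ms≤d N≤d = double-cancel (begin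
        (ms + r) + (ms + r)  ≡⟨ solve 2 (λ m r → (m :+ r) :+ (m :+ r) := (m :+ m) :+ (r :+ r)) refl ms r ⟩
        (ms + ms) + (r + r)  ≤⟨ ℕ.+-mono-≤ 2ms≤d (ℕ.≤-trans (ℕ.+-mono-≤ r≤ r≤) (ℕ.≤-trans budget≤N N≤d)) ⟩
        d + d                ∎)
        where
        open ≤-Reasoning
        open +-*-Solver
        r = k * suc t + length Z
        r≤ : r ≤ spent k c
        r≤ = ℕ.+-mono-≤ (ℕ.*-monoʳ-≤ k t<6) |Z|≤

      out⁻ : ∀ {v u} → u ∈ out D v → arc D v u ≡ true
      out⁻ = proj₂ ∘ ∈-outIn⁻ D {allFin (n D)}

      in⁻ : ∀ {v u} → u ∈ out (reverse D) v → arc D u v ≡ true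
      in⁻ = proj₂ ∘ ∈-outIn⁻ (reverse D) {allFin (n D)}

    module _ (C : Cells {n D} {k} Z 6) {z z′ w w′ : Fin k → Fin (n D)}
      (x→z : ∀ i → arc D (x i) (z i) ≡ true) (z→z′ : ∀ i → arc D (z i) (z′ i) ≡ true)
      (w′→w : ∀ i → arc D (w′ i) (w i) ≡ true) (w→y : ∀ i → arc D (w i) (y i) ≡ true)
      (⊆C : ∀ i → w′ i ∷ z′ i ∷ w i ∷ z i ∷ Cells.cell C₂ i ⊆ Cells.cell C i)
      (z′∉ : ∀ i → z′ i ∉ Cells.occupied C₂) (z′∉missed : ∀ i → z′ i ∉ flat B.missed)
      (w′∉ : ∀ i → w′ i ∉ Cells.occupied C₂) (w′∉missed : ∀ i → w′ i ∉ flat A.missed)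
      (L : Lanes {N = N} Bs As A∩B C) where

      private
        module L = Lanes L

        -- The lane dictates which funnels are used. This is harmless, as `z′ i` and `w′ i` lie off
        -- the missed vertices of all funnels of their kind.
        route : ∀ i → ∃[ l ] (IsPath D (x i) (y i) l × l ⊆ L.territory i)
        route i with caughtᴮ (L.α i) (z′∉ i) (z′∉missed i ∘ ∈-flat⁺ B.missed (L.α i))
                   | caughtᴬ (L.β i) (w′∉ i) (w′∉missed i ∘ ∈-flat⁺ A.missed (L.β i))
        ... | v , v∈ , z′→v , v→end | u , u∈ , u→w′ , end→u
          with concatenate (x→z i) (z→z′ i) z′→v v→end (L.trail i) end→u u→w′ (w′→w i) (w→y i)
        ... | l , t , sub , uniq = l , (Trail⇒Walk t , uniq) , All.lookup inside ∘ sub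
          where
          U⊆ : w′ i ∷ z′ i ∷ w i ∷ z i ∷ Cells.cell C₂ i ⊆ L.territory i
          U⊆ = L.U⊆ i ∘ ⊆C i
          inside : All (_∈ L.territory i)
            ((x i ∷ z i ∷ z′ i ∷ v ∷ B.end (L.α i) ∷ []) ++ L.path i ++
             (A.end (L.β i) ∷ u ∷ w′ i ∷ w i ∷ y i ∷ []))
          inside = U⊆ (there (there (there (there (x∈ i))))) ∷ U⊆ (there (there (there (here refl)))) ∷
            U⊆ (there (here refl)) ∷ L.B⊆ i v∈ ∷ L.B⊆ i (B.end∈ (L.α i)) ∷
            All.++⁺ (All.tabulate (L.path⊆ i))
              (L.A⊆ i (A.end∈ (L.β i)) ∷ L.A⊆ i u∈ ∷ U⊆ (here refl) ∷ U⊆ (there (there (here refl))) ∷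
               U⊆ (there (there (there (there (y∈ i))))) ∷ [])

      routes-along : Routes D x y
      routes-along = (λ i → proj₁ (route i)) , (λ i → proj₁ (proj₂ (route i))) ,
        λ i j v v∈i v∈j → L.disjoint i j (proj₂ (proj₂ (route i)) v∈i) (proj₂ (proj₂ (route j)) v∈j)

    -- Each `z i` lies outside terminals and funnels, so its out-degree is at least that of every
    -- `b j`, and by `missed-total` at most half of its out-neighbours are missed. This leaves room
    -- for `z′ i`; in-degrees do the same for `w i` and `w′ i`.
    routes-through : Routes D x y
    routes-through =
      -- The first argument of `room` is the current cell size. The first two rounds have no missed
      -- vertices to avoid.
      extend C₂ (out D ∘ x) [] (λ i → out-unique D (x i))
        (λ i → room 2 0 (ℕ.m≤m+n 3 3) z≤n (out-degree≥ tour conn N<n (x i)))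
      λ z z∈ _ z∉ C₃ ⊆C₃ ∉C₃ →
      extend C₃ (out (reverse D) ∘ y) [] (λ i → out-unique (reverse D) (y i))
        (λ i → room 3 0 (ℕ.m≤m+n 4 2) z≤n (in-degree≥ tour conn N<n (y i)))
      λ w w∈ _ w∉ C₄ ⊆C₄ ∉C₄ →
      extend C₄ (out D ∘ z) (flat B.missed) (λ i → out-unique D (z i))
        (λ i → room 4 (length (flat B.missed)) (ℕ.m≤m+n 5 1) (missed-total Bs 1≤k 2k≤2^c _ (b-lowest (z∉ i)))
                 (out-degree≥ tour conn N<n (z i)))
      λ z′ z′∈ z′∉missed z′∉ C₅ ⊆C₅ ∉C₅ →
      extend C₅ (out (reverse D) ∘ w) (flat A.missed) (λ i → out-unique (reverse D) (w i))
        (λ i → room 5 (length (flat A.missed)) ℕ.≤-refl (missed-total As 1≤k 2k≤2^c _ (a-lowest (∉C₃ (w∉ i))))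
                 (in-degree≥ tour conn N<n (w i)))
      λ w′ w′∈ w′∉missed w′∉ C₆ ⊆C₆ _ →
      routes-along C₆ (λ i → out⁻ (z∈ i)) (λ i → out⁻ (z′∈ i)) (λ i → in⁻ (w′∈ i)) (λ i → in⁻ (w∈ i))
        (λ i → λ { (here eq) → ⊆C₆ i (here eq)
                 ; (there (here eq)) → ⊆C₆ i (there (⊆C₅ i (here eq)))
                 ; (there (there (here eq))) → ⊆C₆ i (there (⊆C₅ i (there (⊆C₄ i (here eq)))))
                 ; (there (there (there v∈))) → ⊆C₆ i (there (⊆C₅ i (there (⊆C₄ i (there (⊆C₃ i v∈)))))) })
        (λ i → ∉C₃ (∉C₄ (z′∉ i))) z′∉missed (λ i → ∉C₃ (∉C₄ (∉C₅ (w′∉ i)))) w′∉missed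
        (lanes Bs As A∩B C₆ budget≤N conn)

  module _ (x-inj : Inj x) (y-inj : Inj y) (x≢y : ∀ i j → x i ≢ y j) where

    private
      terminals : Fin k → List (Fin (n D))
      terminals i = x i ∷ y i ∷ []

      terminals-disjoint : Disjoint terminals
      terminals-disjoint i j (here refl) (here eq) = x-inj eq
      terminals-disjoint i j (here refl) (there (here eq)) = contradiction eq (x≢y i j)
      terminals-disjoint i j (there (here refl)) (here eq) = contradiction (sym eq) (x≢y j i)
      terminals-disjoint i j (there (here refl)) (there (here eq)) = y-inj eq

      Ts : List (Fin (n D))
      Ts = flat terminals

      |Ts|≤ : length Ts ≤ k * 2
      |Ts|≤ = length-flat terminals 2 (λ _ → ℕ.≤-refl)

      6k≤n : k * 6 ≤ n D
      6k≤n = ℕ.≤-trans (ℕ.m≤m+n (k * 6) _)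
        (ℕ.≤-trans (ℕ.m≤m+n (spent k c) (spent k c)) (ℕ.≤-trans budget≤N (ℕ.<⇒≤ N<n)))

      |Ts|+k≤n : length Ts + k ≤ n D
      |Ts|+k≤n = begin
        length Ts + k   ≤⟨ ℕ.+-monoˡ-≤ k |Ts|≤ ⟩
        k * 2 + k       ≡⟨ solve 1 (λ k → k :* con 2 :+ k := k :* con 3) refl k ⟩
        k * 3           ≤⟨ ℕ.*-monoʳ-≤ k (ℕ.m≤m+n 3 3) ⟩
        k * 6           ≤⟨ 6k≤n ⟩
        n D             ∎
        where open ≤-Reasoning
              open +-*-Solver

      |Ts|+2k≤n : ∀ (b : Fin k → Fin (n D)) → length (Ts ++ tabulate b) + k ≤ n D
      |Ts|+2k≤n b = begin
        length (Ts ++ tabulate b) + k          ≡⟨ cong (_+ k) (length-++ Ts) ⟩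
        length Ts + length (tabulate b) + k    ≡⟨ cong (λ l → length Ts + l + k) (length-tabulate b) ⟩
        length Ts + k + k                      ≤⟨ ℕ.+-monoˡ-≤ k (ℕ.+-monoˡ-≤ k |Ts|≤) ⟩
        k * 2 + k + k                          ≡⟨ solve 1 (λ k → k :* con 2 :+ k :+ k := k :* con 4) refl k ⟩
        k * 4                                  ≤⟨ ℕ.*-monoʳ-≤ k (ℕ.m≤m+n 4 2) ⟩
        k * 6                                  ≤⟨ 6k≤n ⟩
        n D                                    ∎
        where open ≤-Reasoning
              open +-*-Solver

      -- The starts of both kinds are blocked from the outset, so that the funnels built first
      -- cannot use up a start of the second kind.
      blocked : (b a : Fin k → Fin (n D)) → List (Fin (n D))
      blocked b a = Ts ++ tabulate b ++ tabulate a

      ∉blocked : ∀ {b a u} → u ∉ Ts → (∀ i → u ≢ b i) → (∀ i → u ≢ a i) → u ∉ blocked b a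
      ∉blocked {b} u∉Ts u≢b u≢a u∈ with ∈-++⁻ Ts u∈
      ... | inj₁ p = u∉Ts p
      ... | inj₂ p with ∈-++⁻ (tabulate b) p
      ... | inj₁ q = let i , eq = ∈-tabulate⁻ q in u≢b i eq
      ... | inj₂ q = let i , eq = ∈-tabulate⁻ q in u≢a i eq

      a∈blocked : ∀ {b a} i → a i ∈ blocked b a
      a∈blocked {b} i = ∈-++⁺ʳ Ts (∈-++⁺ʳ (tabulate b) (∈-tabulate⁺ i))

      b∈blocked : ∀ {b a} i → b i ∈ blocked b a
      b∈blocked i = ∈-++⁺ʳ Ts (∈-++⁺ˡ (∈-tabulate⁺ i))

    module _ {b a : Fin k → Fin (n D)} (b∉ : ∀ i → b i ∉ Ts) (a∉ : ∀ i → a i ∉ Ts ++ tabulate b)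
      (b-lowest : ∀ {u} → u ∉ Ts → (∀ i → u ≢ b i) → ∀ i → length (out D (b i)) ≤ length (out D u))
      (a-lowest : ∀ {u} → u ∉ Ts ++ tabulate b → (∀ i → u ≢ a i) →
        ∀ i → length (out (reverse D) (a i)) ≤ length (out (reverse D) u))
      (Bs : Funnels D (blocked b a) b c)
      (As : Funnels (reverse D) (blocked b a ++ flat (Funnels.set Bs)) a c) where

      private
        module B = Funnels Bs
        module A = Funnels As

        A∩B : ∀ i j {v} → v ∈ A.set i → v ∉ B.set j
        A∩B i j v∈A v∈B with A.avoids i v∈A
        ... | inj₂ v∉ = v∉ (∈-++⁺ʳ (blocked b a) (∈-flat⁺ B.set j v∈B))
        ... | inj₁ refl with B.avoids j v∈B
        ... | inj₂ v∉ = v∉ (a∈blocked {b} {a} i)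
        ... | inj₁ eq = a∉ i (∈-++⁺ʳ Ts (subst (_∈ tabulate b) (sym eq) (∈-tabulate⁺ j)))

        Z : List (Fin (n D))
        Z = flat B.set ++ flat A.set

        Ts∩Z : ∀ {v} → v ∈ Ts → v ∉ Z
        Ts∩Z v∈ v∈Z with ∈-++⁻ (flat B.set) v∈Z
        Ts∩Z v∈ v∈Z | inj₁ v∈B with ∈-flat⁻ B.set v∈B
        ... | i , v∈Bi with B.avoids i v∈Bi
        ... | inj₁ refl = b∉ i v∈
        ... | inj₂ v∉ = v∉ (∈-++⁺ˡ v∈)
        Ts∩Z v∈ v∈Z | inj₂ v∈A with ∈-flat⁻ A.set v∈A
        ... | i , v∈Ai with A.avoids i v∈Ai
        ... | inj₁ refl = a∉ i (∈-++⁺ˡ v∈)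
        ... | inj₂ v∉ = v∉ (∈-++⁺ˡ (∈-++⁺ˡ v∈))

        C₂ : Cells {n D} {k} Z 2
        C₂ = record { cell = terminals ; disjoint = terminals-disjoint
                    ; avoids = λ i v∈ → Ts∩Z (∈-flat⁺ terminals i v∈) ; size = λ _ → ℕ.≤-refl }

        module _ {u : Fin (n D)} (u∉ : u ∉ Ts ++ Z) where

          ∉Ts : u ∉ Ts
          ∉Ts = u∉ ∘ ∈-++⁺ˡ

          ∉B : ∀ i → u ∉ B.set i
          ∉B i = u∉ ∘ ∈-++⁺ʳ Ts ∘ ∈-++⁺ˡ ∘ ∈-flat⁺ B.set i

          ∉A : ∀ i → u ∉ A.set i
          ∉A i = u∉ ∘ ∈-++⁺ʳ Ts ∘ ∈-++⁺ʳ (flat B.set) ∘ ∈-flat⁺ A.set i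

          ≢b : ∀ i → u ≢ b i
          ≢b i refl = ∉B i (B.start∈ i)

          ≢a : ∀ i → u ≢ a i
          ≢a i refl = ∉A i (A.start∈ i)

          b≤ : ∀ i → length (out D (b i)) ≤ length (out D u)
          b≤ = b-lowest ∉Ts ≢b

          a≤ : ∀ i → length (out (reverse D) (a i)) ≤ length (out (reverse D) u)
          a≤ = a-lowest ([ ∉Ts , (λ u∈ → let i , eq = ∈-tabulate⁻ u∈ in ≢b i eq) ]′ ∘ ∈-++⁻ Ts) ≢a

          ∉both : u ∉ blocked b a
          ∉both = ∉blocked {b} {a} ∉Ts ≢b ≢a

          ∉all : u ∉ blocked b a ++ flat B.set
          ∉all = [ ∉both , (λ u∈ → let i , u∈B = ∈-flat⁻ B.set u∈ in ∉B i u∈B) ]′ ∘ ∈-++⁻ (blocked b a)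

      routes-between : Routes D x y
      routes-between = routes-through Bs As A∩B C₂ (λ _ → here refl) (λ _ → there (here refl)) b≤ a≤
        (λ i u∉ u∉M → B.catches i (∉both u∉) (∉B u∉) u∉M)
        (λ i u∉ u∉M → A.catches i (∉all u∉) (∉A u∉) u∉M)

    disjoint-routes : Routes D x y
    disjoint-routes with k-least (length ∘ out D) k Ts |Ts|+k≤n
    ... | b , b-inj , b∉ , b-lowest
      -- Choosing these starts off the `b i` ensures that no vertex starts funnels of both kinds.
      with k-least (length ∘ out (reverse D)) k (Ts ++ tabulate b) (|Ts|+2k≤n b)
    ... | a , a-inj , a∉ , a-lowest = routes-between b∉ a∉ b-lowest a-lowest Bs
      (funnels (reverse D) (reverse-tournament {D} tour) _ a c a-inj (λ i → ∈-++⁺ˡ (a∈blocked {b} {a} i)))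
      where
      Bs : Funnels D (blocked b a) b c
      Bs = funnels D tour _ b c b-inj (b∈blocked {b} {a})

-- From subsets to lists, and arithmetic with the threshold 12 k log² k.

fromList : ∀ {m} → List (Fin m) → Subset m
fromList [] = ⊥
fromList (v ∷ vs) = ⁅ v ⁆ ∪ fromList vs

∈-fromList⁻ : ∀ {m} (vs : List (Fin m)) {v} → v Subset.∈ fromList vs → v ∈ vs
∈-fromList⁻ [] v∈ = contradiction v∈ Subset.∉⊥
∈-fromList⁻ (u ∷ vs) v∈ with Subset.x∈p∪q⁻ ⁅ u ⁆ (fromList vs) v∈
... | inj₁ p = here (Subset.x∈⁅y⁆⇒x≡y u p)
... | inj₂ p = there (∈-fromList⁻ vs p)

∈-fromList⁺ : ∀ {m} {vs : List (Fin m)} {v} → v ∈ vs → v Subset.∈ fromList vs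
∈-fromList⁺ (here refl) = Subset.x∈p∪q⁺ (inj₁ (Subset.x∈⁅x⁆ _))
∈-fromList⁺ (there v∈) = Subset.x∈p∪q⁺ (inj₂ (∈-fromList⁺ v∈))

∣p∪q∣≤∣p∣+∣q∣ : ∀ {m} (p q : Subset m) → ∣ p ∪ q ∣ ≤ ∣ p ∣ + ∣ q ∣
∣p∪q∣≤∣p∣+∣q∣ [] [] = z≤n
∣p∪q∣≤∣p∣+∣q∣ (false ∷ p) (false ∷ q) = ∣p∪q∣≤∣p∣+∣q∣ p q
∣p∪q∣≤∣p∣+∣q∣ (false ∷ p) (true ∷ q) =
  subst (suc ∣ p ∪ q ∣ ≤_) (sym (ℕ.+-suc ∣ p ∣ ∣ q ∣)) (s≤s (∣p∪q∣≤∣p∣+∣q∣ p q))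
∣p∪q∣≤∣p∣+∣q∣ (true ∷ p) (false ∷ q) = s≤s (∣p∪q∣≤∣p∣+∣q∣ p q)
∣p∪q∣≤∣p∣+∣q∣ (true ∷ p) (true ∷ q) =
  s≤s (ℕ.≤-trans (∣p∪q∣≤∣p∣+∣q∣ p q) (ℕ.+-monoʳ-≤ ∣ p ∣ (ℕ.n≤1+n ∣ q ∣)))

∣fromList∣≤length : ∀ {m} (vs : List (Fin m)) → ∣ fromList vs ∣ ≤ length vs
∣fromList∣≤length {m} [] = ℕ.≤-reflexive (Subset.∣⊥∣≡0 m)
∣fromList∣≤length (v ∷ vs) = ℕ.≤-trans (∣p∪q∣≤∣p∣+∣q∣ ⁅ v ⁆ (fromList vs))
  (subst (λ s → s + ∣ fromList vs ∣ ≤ suc (length vs)) (sym (Subset.∣⁅x⁆∣≡1 v)) (s≤s (∣fromList∣≤length vs)))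

LeThreshold-down : ∀ {m N} k → m ≤ N → LeThreshold N k → LeThreshold m k
LeThreshold-down k m≤N le a b 1≤b small =
  le a b 1≤b (ℕ.<-≤-trans small (ℕ.*-monoˡ-≤ (b * b) m≤N))

-- The rational witnessing that `m` exceeds the threshold lies above log₂ k. If m ≤ N, its square
-- would also be below N / 12k, which forces it to be at most log₂ k.
LeThreshold⇒< : ∀ {N m} k → LeThreshold N k → GtThreshold m k → N < m
LeThreshold⇒< {N} {m} k le (a , b , 1≤b , k^b<2^a , small) =
  ℕ.≰⇒> λ m≤N → ℕ.<⇒≱ k^b<2^a (LeThreshold-down k m≤N le a b 1≤b small)

-- A list may repeat vertices, so its length can only overestimate the set deleted. Lists can thus
-- be concatenated without removing duplicates.
thresholdConnected⇒listConnected : ∀ {N k D} → LeThreshold N k → StronglyThresholdConnected k D →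
  ListConnected N D
thresholdConnected⇒listConnected {k = k} le (_ , conn) T T<N u∉ v∉ =
  let l , t , l∉ = conn (fromList T)
        (LeThreshold-down k (ℕ.≤-trans (s≤s (∣fromList∣≤length T)) T<N) le)
        _ _ (u∉ ∘ ∈-fromList⁻ T) (v∉ ∘ ∈-fromList⁻ T)
  in l , t , All.map (_∘ ∈-fromList⁺) l∉

-- p / q is a rational lower bound for log₂ k.
log-bound⇒LeThreshold : ∀ {k p q} N → 1 ≤ q → 2 ^ p ≤ k ^ q → N * (q * q) ≤ p * p * (12 * k) →
  LeThreshold N k
log-bound⇒LeThreshold {k} {p} {q@(suc _)} N _ 2^p≤k^q N≤ a b 1≤b small =
  ℕ.≮⇒≥ λ k^b<2^a → ℕ.<⇒≱ (ℕ.^-monoˡ-< q k^b<2^a) (begin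
    (2 ^ a) ^ q   ≡⟨ ℕ.^-*-assoc 2 a q ⟩
    2 ^ (a * q)   ≤⟨ ℕ.^-monoʳ-≤ 2 aq≤pb ⟩
    2 ^ (p * b)   ≡⟨ ℕ.^-*-assoc 2 p b ⟨
    (2 ^ p) ^ b   ≤⟨ ℕ.^-monoˡ-≤ b 2^p≤k^q ⟩
    (k ^ q) ^ b   ≡⟨ ℕ.^-*-assoc k q b ⟩
    k ^ (q * b)   ≡⟨ cong (k ^_) (ℕ.*-comm q b) ⟩
    k ^ (b * q)   ≡⟨ ℕ.^-*-assoc k b q ⟨
    (k ^ b) ^ q   ∎)
  where
  open ≤-Reasoning
  open +-*-Solver
  aq≤pb : a * q ≤ p * b
  -- As fractions, (a/b)² < N / 12k ≤ (p/q)²; this is multiplied out.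
  aq≤pb = ℕ.≮⇒≥ λ pb<aq → ℕ.<-irrefl refl (begin-strict
    a * a * (12 * k) * (q * q)     <⟨ ℕ.*-monoˡ-< (q * q) small ⟩
    N * (b * b) * (q * q)          ≡⟨ solve 3 (λ N b q → N :* (b :* b) :* (q :* q) := N :* (q :* q) :* (b :* b)) refl N b q ⟩
    N * (q * q) * (b * b)          ≤⟨ ℕ.*-monoˡ-≤ (b * b) N≤ ⟩
    p * p * (12 * k) * (b * b)     ≡⟨ solve 3 (λ p k b → p :* p :* k :* (b :* b) := p :* b :* (p :* b) :* k) refl p (12 * k) b ⟩
    p * b * (p * b) * (12 * k)     ≤⟨ ℕ.*-monoˡ-≤ (12 * k) (ℕ.*-mono-≤ (ℕ.<⇒≤ pb<aq) (ℕ.<⇒≤ pb<aq)) ⟩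
    a * q * (a * q) * (12 * k)     ≡⟨ solve 3 (λ a k q → a :* q :* (a :* q) :* k := a :* a :* k :* (q :* q)) refl a (12 * k) q ⟩
    a * a * (12 * k) * (q * q)     ∎)

floor-log : ∀ k → 1 ≤ k → ∃[ l ] (2 ^ l ≤ k × k < 2 ^ suc l)
floor-log (suc zero) _ = 0 , ℕ.≤-refl , ℕ.≤-refl
floor-log (suc k@(suc _)) _ with floor-log k (s≤s z≤n)
... | l , lo , hi with suc k <? 2 ^ suc l
... | yes hi′ = l , ℕ.≤-trans lo (ℕ.n≤1+n k) , hi′
... | no ≮ = suc l , ℕ.≮⇒≥ ≮ , ℕ.≤-<-trans hi (ℕ.^-monoʳ-< 2 (s≤s (s≤s z≤n)) (ℕ.n<1+n (suc l)))

-- The budget is k (24 + 4 l), which 12 k l² covers once l ≥ 2. The case l = 1 leaves only k = 3,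
-- where the integer part of the logarithm is too coarse and a finer rational bound takes over.
budget≤threshold : ∀ k l → 3 ≤ k → 2 ^ l ≤ k → k < 2 ^ suc l → LeThreshold (budget k (2 + l)) k
budget≤threshold k zero 3≤k _ k<2 = contradiction (ℕ.≤-trans 3≤k (ℕ.≤-pred k<2)) λ { (s≤s ()) }
budget≤threshold k (suc zero) 3≤k _ k<4 with ℕ.≤-antisym 3≤k (ℕ.≤-pred k<4)
-- 11 / 7 < log₂ 3
... | refl = log-bound⇒LeThreshold {3} {11} {7} 84 (s≤s z≤n) (ℕ.≤ᵇ⇒≤ (2 ^ 11) (3 ^ 7) _) (ℕ.≤ᵇ⇒≤ (84 * 49) (121 * 36) _)
budget≤threshold k l@(suc (suc j)) _ 2^l≤k _ = log-bound⇒LeThreshold {k} {l} {1} (budget k (2 + l)) ℕ.≤-refl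
  (subst (2 ^ l ≤_) (sym (ℕ.*-identityʳ k)) 2^l≤k)
  (subst (budget k (2 + l) * 1 ≤_) (sym slack) (ℕ.m≤m+n (budget k (2 + l) * 1) _))
  where
  open +-*-Solver
  slack : l * l * (12 * k) ≡ budget k (2 + l) * 1 + k * (12 * (j * j) + 44 * j + 16)
  slack = solve 2 (λ k j → let l = con 2 :+ j
                               M = k :* con 6 :+ (k :* (con 3 :+ l) :+ k :* (con 3 :+ l)) in
    l :* l :* (con 12 :* k) := (M :+ M) :* con 1 :+ k :* (con 12 :* (j :* j) :+ con 44 :* j :+ con 16)) refl k j

theorem4p5 : (k : ℕ) → k ≥ 3 → (D : Digraph) → IsTournament D →
    StronglyThresholdConnected k D → Linked k D
theorem4p5 k k≥3 D tour conn with floor-log k (ℕ.≤-trans (s≤s z≤n) k≥3)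
... | l , 2^l≤k , k<2^1+l = large , λ x y x-inj y-inj x≢y →
    -- As k < 2^(l+1), the choice c = l + 2 gives 2k ≤ 2^c, which keeps the missed vertices below
    -- one half. `N` is the budget itself.
    disjoint-routes tour {c = 2 + l} (ℕ.≤-trans (s≤s z≤n) k≥3) 2k≤ ℕ.≤-refl budget<n
      (thresholdConnected⇒listConnected threshold conn) x y (λ {i} {j} → x-inj i j) (λ {i} {j} → y-inj i j) x≢y
  where
  open ≤-Reasoning
  threshold : LeThreshold (budget k (2 + l)) k
  threshold = budget≤threshold k l k≥3 2^l≤k k<2^1+l
  budget<n : budget k (2 + l) < n D
  budget<n = LeThreshold⇒< k threshold (proj₁ conn)
  2k≤ : k + k ≤ 2 ^ (2 + l)
  2k≤ = ℕ.+-mono-≤ (ℕ.<⇒≤ k<2^1+l) (subst (k ≤_) (sym (ℕ.+-identityʳ (2 ^ suc l))) (ℕ.<⇒≤ k<2^1+l))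
  large : 2 * k ≤ n D
  large = begin
    2 * k         ≡⟨ ℕ.*-comm 2 k ⟩
    k * 2         ≤⟨ ℕ.*-monoʳ-≤ k (ℕ.m≤m+n 2 4) ⟩
    k * 6         ≤⟨ ℕ.m≤m+n (k * 6) _ ⟩
    _             ≤⟨ ℕ.m≤m+n _ _ ⟩
    budget k (2 + l)    ≤⟨ ℕ.<⇒≤ budget<n ⟩
    n D           ∎
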